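{- Let $D$ be a web diagram, let $W=W(D)$, and write $D=E_1\oplus E_2\oplus\cdots\oplus E_k$ where each $E_i$ is an indecomposable web diagram. Let $P=P(D)$ be the decomposition poset and $p=|P|=k$. If $E_1,\dots,E_k$ are pairwise distinct web diagrams, then $$M^{(W)}_{D,D}(x)=\sum_{\pi\in\mathcal{L}(P)}x^{1+\operatorname{des}(\pi)}(1+x)^{p-1-\operatorname{des}(\pi)} \quad\text{and}\quad R^{(W)}_{D,D}=\sum_{\pi\in\mathcal{L}(P)}\frac{(-1)^{\operatorname{des}(\pi)}}{p\binom{p-1}{\operatorname{des}(\pi)}}.$$
   Context: A web diagram on $n$ pegs with $L$ edges is a set $D=\{e_j=(x_j,y_j,a_j,b_j):1\le j\le L\}$ of $L$ distinct 4-tuples of positive integers (edge $e_j$ joins peg $x_j$ at height $a_j$ to peg $y_j$ at height $b_j$; height 1 is the bottom) such that (i) $1\le x_j<y_j\le n$, and (ii) for each peg $i$, with $p_i(D)$ the number of $j$ with $x_j=i$ or $y_j=i$, $\{b_j:y_j=i\}\cup\{a_j:x_j=i\}=\{1,\dots,p_i(D)\}$. The sum is $D\oplus D'=D\cup\{(x',y',a'+p_{x'}(D),b'+p_{y'}(D)):(x',y',a',b')\in D'\}$ ($D'$ on top of $D$); $D$ is indecomposable if it is nonempty and not of the form $E\oplus F$ with $E,F$ nonempty. For $X\subseteq D$, $\mathrm{rel}(X)$ relabels, on each peg, the heights of endpoints of edges of $X$ by $1,\dots,\ell_i$ preserving relative order. The web world $W(D)$ is the set of diagrams obtained from $D$ by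 permuting, independently on each peg $i$, the heights $1,\dots,p_i(D)$. An $\ell$-colouring of $D$ is a surjection $c:\{1,\dots,L\}\to\{1,\dots,\ell\}$; with $D_c(t)=\{e_j:c(j)=t\}$, $\mathcal{R}(D,c)=\mathrm{rel}(D_c(1))\oplus\cdots\oplus\mathrm{rel}(D_c(\ell))$. For $D_1,D_2\in W$, $f(D_1,D_2,\ell)$ is the number of $\ell$-colourings $c$ of $D_1$ with $\mathcal{R}(D_1,c)=D_2$; $M^{(W)}_{D_1,D_2}(x)=\sum_{\ell\ge1}x^\ell f(D_1,D_2,\ell)$ and $R^{(W)}_{D_1,D_2}=\sum_{\ell\ge1}\frac{(-1)^{\ell-1}}{\ell}f(D_1,D_2,\ell)$. Decomposition poset: if $D=E_1\oplus\cdots\oplus E_k$, each edge of $D$ comes from the (height-shifted) copy of exactly one summand $E_i$. $P(D)$ is the partial order on $\{E_1,\dots,E_k\}$ generated (reflexive-transitive closure) by the relations $E_i\prec E_j$ whenever $i<j$ and some edge of $D$ coming from $E_i$ has an endpoint below an endpoint of some edge of $D$ coming from $E_j$ on the same peg. A linear extension of $P$ is written as a sequence $\pi=E_{i_1}E_{i_2}\cdots E_{i_k}$ listing all elements with each element after all elements below it; $\mathcal{L}(P)$ is the set of these, and $\operatorname{des}(\pi)$ is the number of $t\in\{1,\dots,k-1\}$ with $i_t>i_{t+1}$. -}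

module Defs where

open import Data.Nat as ℕ using (ℕ; zero; suc; _+_; _*_; _∸_; _≤_; _<_; _<?_; _≟_)
open import Data.Nat.Combinatorics using (_C_)
open import Data.Fin as Fin using (Fin; toℕ)
open import Data.Fin.Properties as FinP using (all?; any?)
open import Data.Bool using (Bool; true; false; if_then_else_)
open import Data.List as List using (List; []; _∷_; _++_; length; map; filter; concatMap; foldr; take; lookup; allFin; sum)
open import Data.List.Membership.Propositional using (_∈_)
open import Data.List.Relation.Unary.All using (All)
open import Data.List.Relation.Unary.Unique.Propositional using (Unique)
open import Data.Vec as Vec using (Vec; toList)
import Data.Vec.Membership.Propositional as VecM
open import Data.Product using (_×_; _,_; ∃; ∃-syntax; Σ-syntax)
open import Data.Product.Properties using (≡-dec)
open import Data.Sum using (_⊎_)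
open import Function.Bundles using (_⇔_)
open import Relation.Binary.PropositionalEquality using (_≡_; _≢_)
open import Relation.Binary.Definitions using (DecidableEquality)
open import Relation.Binary.Construct.Closure.ReflexiveTransitive using (Star)
open import Relation.Nullary using (¬_; Dec; yes; no; ⌊_⌋)
open import Relation.Nullary.Decidable using (_×-dec_)
open import Data.Integer as ℤ using (ℤ)
open import Data.Rational as ℚ using (ℚ; 0ℚ; 1ℚ)

-- An edge (x , y , a , b) joins peg x at height a to peg y at height b.
Edge : Set
Edge = ℕ × ℕ × ℕ × ℕ

_≟E_ : DecidableEquality Edge
_≟E_ = ≡-dec _≟_ (≡-dec _≟_ (≡-dec _≟_ _≟_))

-- A diagram is a finite set of edges, represented by a list
-- (for a web diagram the list is duplicate-free, see IsWeb);
-- the j-th element of the list is the edge e_j.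
Diagram : Set
Diagram = List Edge

endHeights : Edge → ℕ → List ℕ
endHeights (x , y , a , b) i =
  (if ⌊ x ≟ i ⌋ then a ∷ [] else []) ++ (if ⌊ y ≟ i ⌋ then b ∷ [] else [])

heights : Diagram → ℕ → List ℕ
heights D i = concatMap (λ e → endHeights e i) D

pegCount : Diagram → ℕ → ℕ
pegCount D i = length (heights D i)

IsWeb : ℕ → Diagram → Set
IsWeb n D =
  Unique D
  × All (λ { (x , y , a , b) → 1 ≤ x × x < y × y ≤ n × 1 ≤ a × 1 ≤ b }) D
  × (∀ i h → (h ∈ heights D i) ⇔ (1 ≤ h × h ≤ pegCount D i))

_⊆D_ : Diagram → Diagram → Set
D ⊆D D' = ∀ {e} → e ∈ D → e ∈ D'

_≈D_ : Diagram → Diagram → Set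
D ≈D D' = (D ⊆D D') × (D' ⊆D D)

_≈D?_ : (D D' : Diagram) → Dec (D ≈D D')
D ≈D? D' = (D ⊆? D') ×-dec (D' ⊆? D)
  where open import Data.List.Relation.Binary.Subset.DecPropositional _≟E_ using (_⊆?_)

shiftBy : Diagram → Diagram → Diagram
shiftBy D D' = map (λ { (x , y , a , b) → (x , y , a + pegCount D x , b + pegCount D y) }) D'

_⊕_ : Diagram → Diagram → Diagram
D ⊕ D' = D ++ shiftBy D D'

⨁ : List Diagram → Diagram
⨁ Es = foldr _⊕_ [] Es

Indecomposable : ℕ → Diagram → Set
Indecomposable n D =
  (D ≢ []) ×
  ¬ (∃[ E ] ∃[ F ] (IsWeb n E × IsWeb n F × E ≢ [] × F ≢ [] × D ≈D (E ⊕ F)))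

rank : Diagram → ℕ → ℕ → ℕ
rank X i h = suc (length (filter (_<? h) (heights X i)))

rel : Diagram → Diagram
rel X = map (λ { (x , y , a , b) → (x , y , rank X x a , rank X y b) }) X

Colouring : ℕ → Diagram → Set
Colouring ℓ D = Vec (Fin ℓ) (length D)

IsSurj : ∀ {ℓ L} → Vec (Fin ℓ) L → Set
IsSurj {ℓ} {L} c = ∀ (t : Fin ℓ) → ∃[ j ] Vec.lookup c j ≡ t

classOf : ∀ {ℓ} (D : Diagram) → Colouring ℓ D → Fin ℓ → Diagram
classOf [] Vec.[] t = []
classOf (e ∷ D) (c Vec.∷ cs) t =
  if ⌊ c Fin.≟ t ⌋ then e ∷ classOf D cs t else classOf D cs t

𝓡 : ∀ {ℓ} (D : Diagram) → Colouring ℓ D → Diagram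
𝓡 {ℓ} D c = ⨁ (map (λ t → rel (classOf D c t)) (allFin ℓ))

allVecs : (ℓ L : ℕ) → List (Vec (Fin ℓ) L)
allVecs ℓ zero = Vec.[] ∷ []
allVecs ℓ (suc L) = concatMap (λ i → map (i Vec.∷_) (allVecs ℓ L)) (allFin ℓ)

Good : ∀ {ℓ} (D₁ D₂ : Diagram) → Colouring ℓ D₁ → Set
Good D₁ D₂ c = IsSurj c × (𝓡 D₁ c ≈D D₂)

good? : ∀ {ℓ} (D₁ D₂ : Diagram) (c : Colouring ℓ D₁) → Dec (Good D₁ D₂ c)
good? D₁ D₂ c =
  all? (λ t → any? (λ j → Vec.lookup c j Fin.≟ t)) ×-dec (𝓡 D₁ c ≈D? D₂)

f : Diagram → Diagram → ℕ → ℕ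
f D₁ D₂ ℓ = length (filter (good? D₁ D₂) (allVecs ℓ (length D₁)))

Mcoeff : Diagram → Diagram → ℕ → ℕ
Mcoeff D₁ D₂ zero = 0
Mcoeff D₁ D₂ (suc m) = f D₁ D₂ (suc m)

negOnePow : ℕ → ℚ
negOnePow zero = 1ℚ
negOnePow (suc m) = ℚ.- negOnePow m

-- 1/n as a rational (total: 1/0 := 0, never used with n = 0 below)
recip : ℕ → ℚ
recip zero = 0ℚ
recip (suc m) = ℤ.+ 1 ℚ./ suc m

sumℚ : ℕ → (ℕ → ℚ) → ℚ
sumℚ zero g = 0ℚ
sumℚ (suc N) g = sumℚ N g ℚ.+ g (suc N)

-- R_{D₁,D₂} = ∑_{ℓ≥1} (-1)^{ℓ-1}/ℓ f(D₁,D₂,ℓ); the terms vanish for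
-- ℓ > |D₁| (no surjection from |D₁| edges onto ℓ colours).
Rval : Diagram → Diagram → ℚ
Rval D₁ D₂ = sumℚ (length D₁)
  (λ ℓ → negOnePow (ℓ ∸ 1) ℚ.* recip ℓ ℚ.* (ℤ.+ f D₁ D₂ ℓ ℚ./ 1))

-- Polynomials with ℕ coefficients (coefficient lists, lowest first)

Poly : Set
Poly = List ℕ

coeff : Poly → ℕ → ℕ
coeff [] _ = 0
coeff (c ∷ _) zero = c
coeff (_ ∷ cs) (suc m) = coeff cs m

_+P_ : Poly → Poly → Poly
[] +P q = q
(c ∷ cs) +P [] = c ∷ cs
(c ∷ cs) +P (d ∷ ds) = (c + d) ∷ (cs +P ds)

scaleP : ℕ → Poly → Poly
scaleP c = map (c *_)

_*P_ : Poly → Poly → Poly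
[] *P q = []
(c ∷ cs) *P q = scaleP c q +P (0 ∷ (cs *P q))

_^P_ : Poly → ℕ → Poly
p ^P zero = 1 ∷ []
p ^P suc m = p *P (p ^P m)

xP : Poly
xP = 0 ∷ 1 ∷ []

onePlusX : Poly
onePlusX = 1 ∷ 1 ∷ []

sumP : List Poly → Poly
sumP = foldr _+P_ []

-- the height-shifted copy in E₁ ⊕ ⋯ ⊕ E_k of the summand E_i
copyOf : (Es : List Diagram) → Fin (length Es) → Diagram
copyOf Es i = shiftBy (⨁ (take (toℕ i) Es)) (lookup Es i)

EndAt : Edge → ℕ → ℕ → Set
EndAt (x , y , a , b) q h = (x ≡ q × a ≡ h) ⊎ (y ≡ q × b ≡ h)

Gen : (Es : List Diagram) → Fin (length Es) → Fin (length Es) → Set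
Gen Es i j =
  (i Fin.< j) ×
  ∃[ e ] ∃[ e' ] ∃[ q ] ∃[ h ] ∃[ h' ]
    (e ∈ copyOf Es i × e' ∈ copyOf Es j × EndAt e q h × EndAt e' q h' × h < h')

IsLinExt : (Es : List Diagram) → Vec (Fin (length Es)) (length Es) → Set
IsLinExt Es π =
  (∀ i → i VecM.∈ π) ×
  (∀ s t → Star (Gen Es) (Vec.lookup π s) (Vec.lookup π t) →
           Vec.lookup π s ≢ Vec.lookup π t → s Fin.< t)

desL : ∀ {k} → List (Fin k) → ℕ
desL [] = 0
desL (a ∷ []) = 0
desL (a ∷ b ∷ rest) = (if ⌊ toℕ b <? toℕ a ⌋ then 1 else 0) + desL (b ∷ rest)

des : ∀ {k m} → Vec (Fin k) m → ℕ
des π = desL (toList π)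

{-# OPTIONS --safe #-}
-- In 𝓡(D,c) the endpoints on a peg are ordered by (colour, old height). If 𝓡(D,c) = D, this gives a
-- permutation φ of the edges of D such that c ∘ φ⁻¹, and then the index of the summand containing φ⁻¹(e),
-- is monotone along the pegs on each copy of a summand. A monotone function on an indecomposable diagram is
-- constant, since a threshold between two of its values would decompose the diagram. So φ⁻¹ maps each copy
-- into one copy; by counting, φ permutes the copies, and each copy has one colour. Hence φ preserves the
-- order within a copy, so it maps E_i onto an equal diagram, and distinctness makes φ fix every copy. It
-- follows that the good colourings are the order-preserving surjections g : P → {1,…,ℓ}, P being labelled naturally.
--
-- Sorting P by (g(i), i) turns g into a linear extension π and a word g ∘ π with steps 0 and 1 whose step
-- is 1 at each descent of π; the words for π are counted by x^(1+des π) (1+x)^(p-1-des π).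
-- For R, the functional x^ℓ ↦ (-1)^(ℓ-1)/ℓ takes the value (-1)^d / (p C(p-1,d)) at x^(1+d) (1+x)^m,
-- p = d+m+1, by induction on m, because x^(1+d) (1+x)^(m+1) = x^(1+d) (1+x)^m + x^(2+d) (1+x)^m.

module Submission where

open import Defs
open import Data.Nat using (ℕ; _∸_; _*_; _+_)
open import Data.Nat.Combinatorics using (_C_)
open import Data.Fin using (Fin)
open import Data.List using (List; []; length; map; foldr; lookup)
open import Data.List.Membership.Propositional using (_∈_)
open import Data.List.Relation.Unary.All using (All)
open import Data.List.Relation.Unary.Unique.Propositional using (Unique)
open import Data.Vec using (Vec)
open import Data.Product using (_×_)
open import Function.Bundles using (_⇔_)
open import Relation.Binary.PropositionalEquality using (_≡_; _≢_)
open import Relation.Nullary using (¬_)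
open import Data.Rational as ℚ using (ℚ; 0ℚ)
open import Data.Nat using (zero; suc; _≤_; _<_; _≤′_; ≤′-refl; ≤′-step; z≤n; s≤s; _≟_; _<?_; _≤?_; _!; ≢-nonZero; ≢-nonZero⁻¹)
import Data.Nat.Properties as ℕ
open import Data.Nat.Combinatorics using (nCn≡1; nCk≡n!/k![n-k]!; k![n∸k]!∣n!)
open import Data.Nat.DivMod using (m/n*n≡m)
open import Data.Nat.Tactic.RingSolver using (solve-∀)
import Data.Integer as ℤ
import Data.Integer.Properties as ℤ
open import Data.Rational using (1ℚ; toℚᵘ)
import Data.Rational.Properties as ℚ
open import Data.Rational.Unnormalised as ℚᵘ using (mkℚᵘ; *≡*)
import Data.Rational.Unnormalised.Properties as ℚᵘ
open import Data.Rational.Solver using (module +-*-Solver)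
open import Data.Bool using (if_then_else_)
open import Data.Fin as Fin using (toℕ)
import Data.Fin.Properties as Fin
open import Data.List using (_∷_; _++_; filter; concatMap; allFin; tabulate; take)
import Data.List.Properties as List
open import Data.List.Relation.Unary.Any as Any using (here; there)
open import Data.List.Relation.Unary.Any.Properties using (lookup-index)
open import Data.List.Membership.Propositional using (lose)
open import Data.List.Membership.Propositional.Properties
  using (∈-map⁺; ∈-map⁻; ∈-++⁺ˡ; ∈-++⁺ʳ; ∈-++⁻; ∈-filter⁺; ∈-filter⁻; ∈-lookup; ∈-allFin; ∈-∃++)
open import Data.List.Relation.Unary.All as All using ([]; _∷_)
import Data.List.Relation.Unary.Unique.Propositional.Properties as Unique
open import Data.List.Relation.Unary.AllPairs using ([]; _∷_)
open import Data.Vec as Vec using ([]; _∷_)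
import Data.Vec.Properties as Vec
open import Data.Vec.Membership.Propositional using () renaming (_∈_ to _∈ᵛ_)
open import Data.Vec.Membership.Propositional.Properties using () renaming (∈-lookup to ∈ᵛ-lookup)
open import Data.Vec.Relation.Unary.Any using () renaming (here to hereᵛ; there to thereᵛ)
open import Data.Product using (_,_; proj₁; proj₂; ∃; ∃-syntax; Σ-syntax)
open import Data.Sum using (_⊎_; inj₁; inj₂; [_,_]′)
open import Data.Empty using (⊥)
open import Data.Unit using (⊤; tt)
open import Function using (_∘_; id)
open import Function.Bundles using (mk⇔; Equivalence)
open import Relation.Binary.PropositionalEquality using (refl; sym; trans; cong; cong₂; subst; subst₂; module ≡-Reasoning)
open import Relation.Binary.Definitions using (tri<; tri≈; tri>)
open import Relation.Binary.Construct.Closure.ReflexiveTransitive using (Star; ε; _◅_)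
open import Relation.Nullary using (Dec; yes; no; ⌊_⌋; contradiction)
open import Relation.Nullary.Decidable using (¬?)
open import Relation.Unary using (Decidable)

-- Heights in 𝓡(D,c)

-- The condition 𝓡(D,c) = D compares sets of edges, so it does not say that each edge stays in
-- place: an edge may take the place of another one, and a priori whole copies may be interchanged
-- or mixed. The colour has to be settled before the index of the copy. That one image lies below
-- another on a peg says only that its pair (colour, old height) is smaller, and the old heights,
-- which order the copies, decide only once the colours are known to agree. The inverse of φ is
-- available only as an existence statement, so it enters through relations, and bijections are
-- replaced by pigeonhole lemmas for relations. Colours are turned into functions from edges to ℕ,
-- so that one threshold argument serves for colours and for indices of copies. For R, the sum in
-- `Rval` stops at ℓ = |D| while the polynomials have degree k, whence the need for k ≤ |D|. The
-- induction on m rests on the fact that the reciprocals of p C(p-1,d) form the harmonic triangle of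
-- Leibniz.

raise : (ℕ → ℕ → ℕ) → Edge → Edge
raise α (x , y , a , b) = x , y , α x a , α y b

EndAt-raise⁺ : ∀ α e {q h} → EndAt e q h → EndAt (raise α e) q (α q h)
EndAt-raise⁺ α e (inj₁ (refl , refl)) = inj₁ (refl , refl)
EndAt-raise⁺ α e (inj₂ (refl , refl)) = inj₂ (refl , refl)

EndAt-raise⁻ : ∀ α e {q h'} → EndAt (raise α e) q h' → ∃[ h ] EndAt e q h × h' ≡ α q h
EndAt-raise⁻ α e (inj₁ (refl , refl)) = _ , inj₁ (refl , refl) , refl
EndAt-raise⁻ α e (inj₂ (refl , refl)) = _ , inj₂ (refl , refl) , refl

raise-cong : ∀ α β e → (∀ {q h} → EndAt e q h → α q h ≡ β q h) → raise α e ≡ raise β e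
raise-cong α β (x , y , a , b) eq =
  cong₂ (λ a' b' → x , y , a' , b') (eq (inj₁ (refl , refl))) (eq (inj₂ (refl , refl)))

module _ {A : Set} {P : Set} {h : A} where
  ∈-if⁺ : (d : Dec P) → P → h ∈ (if ⌊ d ⌋ then h ∷ [] else [])
  ∈-if⁺ (yes _) p = here refl
  ∈-if⁺ (no ¬p) p = contradiction p ¬p

  ∈-if⁻ : ∀ {a} (d : Dec P) → h ∈ (if ⌊ d ⌋ then a ∷ [] else []) → P × a ≡ h
  ∈-if⁻ (yes p) (here refl) = p , refl

  length-if : ∀ {a : A} (d : Dec P) → length (if ⌊ d ⌋ then h ∷ [] else []) ≡ length (if ⌊ d ⌋ then a ∷ [] else [])
  length-if (yes _) = refl
  length-if (no _) = refl

∈-endHeights⁺ : ∀ e {q h} → EndAt e q h → h ∈ endHeights e q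
∈-endHeights⁺ (x , y , a , b) {q} (inj₁ (p , refl)) = ∈-++⁺ˡ (∈-if⁺ (x ≟ q) p)
∈-endHeights⁺ (x , y , a , b) {q} (inj₂ (p , refl)) = ∈-++⁺ʳ _ (∈-if⁺ (y ≟ q) p)

∈-endHeights⁻ : ∀ e {q h} → h ∈ endHeights e q → EndAt e q h
∈-endHeights⁻ (x , y , a , b) {q} h∈ with ∈-++⁻ (if ⌊ x ≟ q ⌋ then a ∷ [] else []) h∈
... | inj₁ p = inj₁ (∈-if⁻ (x ≟ q) p)
... | inj₂ p = inj₂ (∈-if⁻ (y ≟ q) p)

∈-heights⁺ : ∀ {D e q h} → e ∈ D → EndAt e q h → h ∈ heights D q
∈-heights⁺ (here {x = e} refl) end = ∈-++⁺ˡ (∈-endHeights⁺ e end)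
∈-heights⁺ {e' ∷ D} {q = q} (there e∈) end = ∈-++⁺ʳ (endHeights e' q) (∈-heights⁺ e∈ end)

∈-heights⁻ : ∀ D {q h} → h ∈ heights D q → ∃[ e ] e ∈ D × EndAt e q h
∈-heights⁻ (e ∷ D) {q} h∈ with ∈-++⁻ (endHeights e q) h∈
... | inj₁ p = e , here refl , ∈-endHeights⁻ e p
... | inj₂ p with ∈-heights⁻ D p
...   | e' , e'∈ , end = e' , there e'∈ , end

pegCount-∷ : ∀ e D q → pegCount (e ∷ D) q ≡ length (endHeights e q) + pegCount D q
pegCount-∷ e D q = List.length-++ (endHeights e q)

pegCount-++ : ∀ X Y q → pegCount (X ++ Y) q ≡ pegCount X q + pegCount Y q
pegCount-++ [] Y q = refl
pegCount-++ (e ∷ X) Y q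
  rewrite pegCount-∷ e (X ++ Y) q | pegCount-++ X Y q | pegCount-∷ e X q
  = sym (ℕ.+-assoc (length (endHeights e q)) (pegCount X q) (pegCount Y q))

length-endHeights-raise : ∀ α e q → length (endHeights (raise α e) q) ≡ length (endHeights e q)
length-endHeights-raise α (x , y , a , b) q =
  trans (List.length-++ (if ⌊ x ≟ q ⌋ then _ ∷ [] else []))
    (trans (cong₂ _+_ (length-if {a = a} (x ≟ q)) (length-if {a = b} (y ≟ q)))
      (sym (List.length-++ (if ⌊ x ≟ q ⌋ then a ∷ [] else []))))

pegCount-raise : ∀ α X q → pegCount (map (raise α) X) q ≡ pegCount X q
pegCount-raise α [] q = refl
pegCount-raise α (e ∷ X) q
  rewrite pegCount-∷ (raise α e) (map (raise α) X) q | pegCount-∷ e X q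
  = cong₂ _+_ (length-endHeights-raise α e q) (pegCount-raise α X q)

pegCount-⊕ : ∀ X Y q → pegCount (X ⊕ Y) q ≡ pegCount X q + pegCount Y q
pegCount-⊕ X Y q =
  trans (pegCount-++ X (shiftBy X Y) q)
        (cong (pegCount X q +_) (pegCount-raise (λ q h → h + pegCount X q) Y q))

pegCount-rel : ∀ X q → pegCount (rel X) q ≡ pegCount X q
pegCount-rel X = pegCount-raise (rank X) X

module _ {P : Edge → Set} (P? : Decidable P) where
  pegCount-filter-≤ : ∀ X q → pegCount (filter P? X) q ≤ pegCount X q
  pegCount-filter-≤ [] q = z≤n
  pegCount-filter-≤ (e ∷ X) q with P? e
  ... | yes _ rewrite pegCount-∷ e (filter P? X) q | pegCount-∷ e X q
    = ℕ.+-monoʳ-≤ (length (endHeights e q)) (pegCount-filter-≤ X q)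
  ... | no _ rewrite pegCount-∷ e X q
    = ℕ.≤-trans (pegCount-filter-≤ X q) (ℕ.m≤n+m _ (length (endHeights e q)))

  pegCount-filter-split : ∀ {Q R : Edge → Set} (Q? : Decidable Q) (R? : Decidable R) →
    (∀ e → P e → Q e ⊎ R e) → (∀ e → Q e → P e) → (∀ e → R e → P e) → (∀ e → Q e → ¬ R e) →
    ∀ X q → pegCount (filter P? X) q ≡ pegCount (filter Q? X) q + pegCount (filter R? X) q
  pegCount-filter-split Q? R? split Q⊆ R⊆ disj [] q = refl
  pegCount-filter-split Q? R? split Q⊆ R⊆ disj (e ∷ X) q
    with ih ← pegCount-filter-split Q? R? split Q⊆ R⊆ disj X q | P? e | Q? e | R? e
  ... | yes p | yes a | yes b = contradiction b (disj e a)
  ... | yes p | no ¬a | no ¬b = [ (λ a → contradiction a ¬a) , (λ b → contradiction b ¬b) ]′ (split e p)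
  ... | no ¬p | yes a | _     = contradiction (Q⊆ e a) ¬p
  ... | no ¬p | no _  | yes b = contradiction (R⊆ e b) ¬p
  ... | no _  | no _  | no _  = ih
  ... | yes p | yes a | no ¬b
    rewrite pegCount-∷ e (filter P? X) q | pegCount-∷ e (filter Q? X) q | ih
    = sym (ℕ.+-assoc (length (endHeights e q)) _ _)
  ... | yes p | no ¬a | yes b
    rewrite pegCount-∷ e (filter P? X) q | pegCount-∷ e (filter R? X) q | ih
    = trans (sym (ℕ.+-assoc (length (endHeights e q)) _ _))
        (trans (cong (_+ pegCount (filter R? X) q) (ℕ.+-comm (length (endHeights e q)) _))
          (ℕ.+-assoc (pegCount (filter Q? X) q) _ _))

module _ {P Q : ℕ → Set} (P? : Decidable P) (Q? : Decidable Q) (P⊆Q : ∀ {x} → P x → Q x) where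
  length-filter-⊆ : ∀ xs → length (filter P? xs) ≤ length (filter Q? xs)
  length-filter-⊆ [] = z≤n
  length-filter-⊆ (x ∷ xs) with P? x | Q? x
  ... | yes _ | yes _ = s≤s (length-filter-⊆ xs)
  ... | yes p | no ¬q = contradiction (P⊆Q p) ¬q
  ... | no _  | yes _ = ℕ.≤-trans (length-filter-⊆ xs) (ℕ.n≤1+n _)
  ... | no _  | no _  = length-filter-⊆ xs

  length-filter-⊂ : ∀ {x xs} → x ∈ xs → ¬ P x → Q x → length (filter P? xs) < length (filter Q? xs)
  length-filter-⊂ {xs = x ∷ xs} (here refl) ¬p q with P? x | Q? x
  ... | yes p | _     = contradiction p ¬p
  ... | no _  | yes _ = s≤s (length-filter-⊆ xs)
  ... | no _  | no ¬q = contradiction q ¬q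
  length-filter-⊂ {xs = x ∷ xs} (there x∈) ¬p q with P? x | Q? x
  ... | yes _ | yes _ = s≤s (length-filter-⊂ x∈ ¬p q)
  ... | yes p | no ¬q = contradiction (P⊆Q p) ¬q
  ... | no _  | yes _ = ℕ.<-trans (length-filter-⊂ x∈ ¬p q) (ℕ.n<1+n _)
  ... | no _  | no _  = length-filter-⊂ x∈ ¬p q

rank-mono-< : ∀ X q {h h'} → h ∈ heights X q → h < h' → rank X q h < rank X q h'
rank-mono-< X q {h} {h'} h∈ h<h' =
  s≤s (length-filter-⊂ (_<? h) (_<? h') (λ x<h → ℕ.<-trans x<h h<h') h∈ (ℕ.<-irrefl refl) h<h')

-- The entry h fails the test `_<? h`, so the filter loses at least one entry; this pays for the
-- `suc` in `rank`.
rank-≤ : ∀ X q {h} → h ∈ heights X q → rank X q h ≤ pegCount X q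
rank-≤ X q {h} h∈ = List.filter-notAll (_<? h) (heights X q) (lose h∈ (ℕ.<-irrefl refl))

-- Colour classes and the layers of 𝓡(D,c)

cls : Diagram → (Edge → ℕ) → ℕ → Diagram
cls D col t = filter (λ e → col e ≟ t) D

-- The room that the colours below t take up on peg q, which is the amount by which the layer of
-- colour t is lifted in 𝓡(D,c).
base : Diagram → (Edge → ℕ) → ℕ → ℕ → ℕ
base D col t q = pegCount (filter (λ e → col e <? t) D) q

-- The height that an endpoint of colour t at height h on peg q receives in 𝓡(D,c).
newHeight : Diagram → (Edge → ℕ) → ℕ → ℕ → ℕ → ℕ
newHeight D col t q h = rank (cls D col t) q h + base D col t q

newEdge : Diagram → (Edge → ℕ) → Edge → Edge
newEdge D col e = raise (newHeight D col (col e)) e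

-- The sum of the layers of the r colours from s on. A variable s lets the recursion peel off the
-- lowest layer; 𝓡(D,c) is the case s = 0, r = ℓ.
layers : Diagram → (Edge → ℕ) → ℕ → ℕ → Diagram
layers D col s zero = []
layers D col s (suc r) = rel (cls D col s) ⊕ layers D col (suc s) r

module _ (D : Diagram) (col : Edge → ℕ) where

  base-suc : ∀ t q → base D col (suc t) q ≡ base D col t q + pegCount (cls D col t) q
  base-suc t q = pegCount-filter-split (λ e → col e <? suc t) (λ e → col e <? t) (λ e → col e ≟ t)
    (λ e p → ℕ.m≤n⇒m<n∨m≡n (ℕ.≤-pred p)) (λ e p → ℕ.<-trans p (ℕ.n<1+n t)) (λ { e refl → ℕ.n<1+n t })
    (λ e p eq → ℕ.<-irrefl eq p) D q

  base-mono : ∀ {s t} → s ≤ t → ∀ q → base D col s q ≤ base D col t q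
  base-mono {s} {t} s≤t q = go (ℕ.≤⇒≤′ s≤t)
    where
    go : ∀ {t} → s ≤′ t → base D col s q ≤ base D col t q
    go ≤′-refl = ℕ.≤-refl
    go {suc t} (≤′-step p) rewrite base-suc t q = ℕ.≤-trans (go p) (ℕ.m≤m+n _ _)

  base-0 : ∀ q → base D col 0 q ≡ 0
  base-0 q = cong (λ X → pegCount X q) (List.filter-none (λ e → col e <? 0) (All.tabulate {xs = D} (λ _ ())))

  private
    α : ℕ → ℕ → ℕ → ℕ
    α t q h = h + base D col t q

  shift-suc : ∀ s q h → h + pegCount (rel (cls D col s)) q + base D col s q ≡ h + base D col (suc s) q
  shift-suc s q h rewrite pegCount-rel (cls D col s) q | base-suc s q =
    trans (ℕ.+-assoc h _ _) (cong (h +_) (ℕ.+-comm _ (base D col s q)))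

  -- A tail of the sum, taken alone, stands on the floor. Lifting it by `base` at s brings its edges
  -- to their final heights, and `shift-suc` carries this correction past one ⊕.
  layers⁻ : ∀ s r {e'} → e' ∈ layers D col s r →
    ∃[ e ] e ∈ D × col e < s + r × raise (α s) e' ≡ newEdge D col e
  layers⁻ s (suc r) {e'} e'∈ with ∈-++⁻ (rel (cls D col s)) e'∈
  ... | inj₁ p with ∈-map⁻ _ p
  ...   | e , e∈ , refl with ∈-filter⁻ (λ e → col e ≟ s) {xs = D} e∈
  ...     | e∈D , refl = e , e∈D , ℕ.m<m+n (col e) (s≤s z≤n) , refl
  layers⁻ s (suc r) {e'} e'∈ | inj₂ p with ∈-map⁻ _ p
  ... | e″ , e″∈ , refl with layers⁻ (suc s) r e″∈
  ... | e , e∈ , lt , eq = e , e∈ , subst (col e <_) (sym (ℕ.+-suc s r)) lt ,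
    trans (raise-cong _ _ e″ λ {q} {h} _ → shift-suc s q h) eq

  layers⁺ : ∀ s r {e} → e ∈ D → s ≤ col e → col e < s + r →
    ∃[ e' ] e' ∈ layers D col s r × raise (α s) e' ≡ newEdge D col e
  layers⁺ s zero {e} e∈ s≤ lt = contradiction s≤ (ℕ.<⇒≱ (subst (col e <_) (ℕ.+-identityʳ s) lt))
  layers⁺ s (suc r) {e} e∈ s≤ lt with ℕ.m≤n⇒m<n∨m≡n s≤
  ... | inj₂ refl = _ , ∈-++⁺ˡ (∈-map⁺ _ (∈-filter⁺ (λ e → col e ≟ s) e∈ refl)) , refl
  ... | inj₁ s< with layers⁺ (suc s) r e∈ s< (subst (col e <_) (ℕ.+-suc s r) lt)
  ...   | e″ , e″∈ , eq = _ , ∈-++⁺ʳ (rel (cls D col s)) (∈-map⁺ _ e″∈) ,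
    trans (raise-cong _ _ e″ λ {q} {h} _ → shift-suc s q h) eq

  raise-base-0 : ∀ e → raise (α 0) e ≡ e
  raise-base-0 e = raise-cong (α 0) (λ q h → h) e λ {q} {h} _ →
    trans (cong (h +_) (base-0 q)) (ℕ.+-identityʳ h)

  ∈-layers⁻ : ∀ {ℓ e'} → e' ∈ layers D col 0 ℓ → ∃[ e ] e ∈ D × e' ≡ newEdge D col e
  ∈-layers⁻ {ℓ} {e'} e'∈ with layers⁻ 0 ℓ e'∈
  ... | e , e∈ , _ , eq = e , e∈ , trans (sym (raise-base-0 e')) eq

  ∈-layers⁺ : ∀ {ℓ e} → e ∈ D → col e < ℓ → newEdge D col e ∈ layers D col 0 ℓ
  ∈-layers⁺ {ℓ} {e} e∈ lt with layers⁺ 0 ℓ e∈ z≤n lt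
  ... | e' , e'∈ , eq = subst (_∈ layers D col 0 ℓ) (trans (sym (raise-base-0 e')) eq) e'∈

  newHeight-≤-base : ∀ {u q h} → u ∈ D → EndAt u q h → newHeight D col (col u) q h ≤ base D col (suc (col u)) q
  newHeight-≤-base {u} {q} {h} u∈ end = begin
    rank (cls D col (col u)) q h + base D col (col u) q
      ≤⟨ ℕ.+-monoˡ-≤ _ (rank-≤ (cls D col (col u)) q (∈-heights⁺ (∈-filter⁺ (λ e → col e ≟ col u) u∈ refl) end)) ⟩
    pegCount (cls D col (col u)) q + base D col (col u) q
      ≡⟨ trans (ℕ.+-comm _ (base D col (col u) q)) (sym (base-suc (col u) q)) ⟩
    base D col (suc (col u)) q ∎
    where open ℕ.≤-Reasoning

  newHeight-≤ : ∀ {u q h} → u ∈ D → EndAt u q h → newHeight D col (col u) q h ≤ pegCount D q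
  newHeight-≤ {u} {q} u∈ end =
    ℕ.≤-trans (newHeight-≤-base u∈ end) (pegCount-filter-≤ (λ e → col e <? suc (col u)) D q)

  -- The layer of u ends at `base` of the next colour, and every rank is at least 1, so h' can be
  -- arbitrary.
  newHeight-mono-colour : ∀ {u q h t h'} → u ∈ D → EndAt u q h → col u < t →
    newHeight D col (col u) q h < newHeight D col t q h'
  newHeight-mono-colour {u} {q} {h} {t} {h'} u∈ end lt = begin-strict
    newHeight D col (col u) q h ≤⟨ newHeight-≤-base u∈ end ⟩
    base D col (suc (col u)) q  ≤⟨ base-mono lt q ⟩
    base D col t q              <⟨ s≤s (ℕ.m≤n+m _ _) ⟩
    newHeight D col t q h'      ∎
    where open ℕ.≤-Reasoning

  newHeight-mono-height : ∀ {u q h h'} → u ∈ D → EndAt u q h → h < h' →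
    newHeight D col (col u) q h < newHeight D col (col u) q h'
  newHeight-mono-height {u} {q} u∈ end lt = ℕ.+-monoˡ-< (base D col (col u) q)
    (rank-mono-< (cls D col (col u)) q (∈-heights⁺ (∈-filter⁺ (λ e → col e ≟ col u) u∈ refl) end) lt)

-- Monotone colourings and indecomposability

module _ {p : ℕ} (F : ℕ → ℕ → Set)
  (total : ∀ {h} → 1 ≤ h → h ≤ p → ∃[ h' ] F h h')
  (mono : ∀ {h₁ h₁' h₂ h₂'} → F h₁ h₁' → F h₂ h₂' → h₁ < h₂ → h₁' < h₂') where

  -- Each height from 1 up to h has an image, and the images increase strictly from at least 1. `F`
  -- is a relation because heights are linked through some endpoint that is only known to exist.
  strictlyMonotone-lower : (∀ {h h'} → F h h' → 1 ≤ h') → ∀ h {h'} → h ≤ p → F h h' → h ≤ h'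
  strictlyMonotone-lower pos zero h≤p Fh = z≤n
  strictlyMonotone-lower pos (suc zero) h≤p Fh = pos Fh
  strictlyMonotone-lower pos (suc h@(suc _)) h≤p Fh =
    ℕ.≤-<-trans (strictlyMonotone-lower pos h (ℕ.<⇒≤ h≤p) (proj₂ below)) (mono (proj₂ below) Fh (ℕ.n<1+n _))
    where
    below : ∃[ h' ] F h h'
    below = total (s≤s z≤n) (ℕ.<⇒≤ h≤p)

  -- The bound from the other end: the p ∸ h heights above h need as many different values above h',
  -- none exceeding p.
  strictlyMonotone-upper : (∀ {h h'} → F h h' → h' ≤ p) → ∀ {h h'} → h ≤ p → F h h' → h' ≤ h
  strictlyMonotone-upper bound {h} {h'} h≤p Fh =
    ℕ.+-cancelʳ-≤ (p ∸ h) h' h (subst (h' + (p ∸ h) ≤_) (sym (ℕ.m+[n∸m]≡n h≤p)) (go (p ∸ h) (ℕ.m+[n∸m]≡n h≤p) Fh))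
    where
    go : ∀ j {h h'} → h + j ≡ p → F h h' → h' + j ≤ p
    go zero {h' = h'} eq Fh = subst (_≤ p) (sym (ℕ.+-identityʳ h')) (bound Fh)
    go (suc j) {h} {h'} eq Fh
      with eq' ← trans (sym (ℕ.+-suc h j)) eq
      with total (s≤s z≤n) (subst (suc h ≤_) eq' (ℕ.m≤m+n (suc h) j))
    ... | h″ , Fh″ = begin
      h' + suc j ≡⟨ ℕ.+-suc h' j ⟩
      suc h' + j ≤⟨ ℕ.+-monoˡ-≤ j (mono Fh Fh″ (ℕ.n<1+n h)) ⟩
      h″ + j ≤⟨ go j eq' Fh″ ⟩
      p ∎
      where open ℕ.≤-Reasoning

module _ {n : ℕ} {D : Diagram} (web : IsWeb n D) where
  heights⇒bounds : ∀ {e q h} → e ∈ D → EndAt e q h → 1 ≤ h × h ≤ pegCount D q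
  heights⇒bounds {q = q} {h} e∈ end = Equivalence.to (proj₂ (proj₂ web) q h) (∈-heights⁺ e∈ end)

  bounds⇒heights : ∀ {q h} → 1 ≤ h → h ≤ pegCount D q → ∃[ e ] e ∈ D × EndAt e q h
  bounds⇒heights {q} {h} 1≤h h≤p = ∈-heights⁻ D (Equivalence.from (proj₂ (proj₂ web) q h) (1≤h , h≤p))

Monotone : Diagram → (Edge → ℕ) → Set
Monotone D col = ∀ {u v q h h'} → u ∈ D → v ∈ D → EndAt u q h → EndAt v q h' → h < h' → col u ≤ col v

module _ {n : ℕ} {D : Diagram} (web : IsWeb n D) {col : Edge → ℕ} (col-mono : Monotone D col) where

  -- As col is monotone along the pegs, ordering by (colour, height) is ordering by height. The
  -- passage to new heights is therefore strictly increasing from 1, ..., p into 1, ..., p, which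
  -- leaves only the identity.
  newHeight-id : ∀ {u q h} → u ∈ D → EndAt u q h → newHeight D col (col u) q h ≡ h
  newHeight-id {u} {q} {h} u∈ end = ℕ.≤-antisym
    (strictlyMonotone-upper F total mono upper h≤p (u , u∈ , end , refl))
    (strictlyMonotone-lower F total mono lower h h≤p (u , u∈ , end , refl))
    where
    F : ℕ → ℕ → Set
    F h h' = ∃[ u ] u ∈ D × EndAt u q h × h' ≡ newHeight D col (col u) q h

    total : ∀ {h} → 1 ≤ h → h ≤ pegCount D q → ∃[ h' ] F h h'
    total 1≤h h≤p with bounds⇒heights web 1≤h h≤p
    ... | e , e∈ , end = _ , e , e∈ , end , refl

    mono : ∀ {h₁ h₁' h₂ h₂'} → F h₁ h₁' → F h₂ h₂' → h₁ < h₂ → h₁' < h₂'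
    mono {h₁} {h₂ = h₂} (u , u∈ , eu , refl) (v , v∈ , ev , refl) lt with ℕ.m≤n⇒m<n∨m≡n (col-mono u∈ v∈ eu ev lt)
    ... | inj₁ lt' = newHeight-mono-colour D col u∈ eu lt'
    ... | inj₂ eq = subst (λ t → newHeight D col (col u) q h₁ < newHeight D col t q h₂) eq (newHeight-mono-height D col u∈ eu lt)

    upper : ∀ {h h'} → F h h' → h' ≤ pegCount D q
    upper (u , u∈ , eu , refl) = newHeight-≤ D col u∈ eu

    lower : ∀ {h h'} → F h h' → 1 ≤ h'
    lower (u , u∈ , eu , refl) = s≤s z≤n

    h≤p : h ≤ pegCount D q
    h≤p = proj₂ (heights⇒bounds web u∈ end)

  newEdge-id : ∀ {e} → e ∈ D → newEdge D col e ≡ e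
  newEdge-id {e} e∈ = raise-cong (newHeight D col (col e)) (λ _ h → h) e (newHeight-id e∈)

  layers-id : ∀ {ℓ} → (∀ {e} → e ∈ D → col e < ℓ) → layers D col 0 ℓ ≈D D
  layers-id {ℓ} bound = to , from
    where
    to : layers D col 0 ℓ ⊆D D
    to e'∈ with ∈-layers⁻ D col {ℓ} e'∈
    ... | e , e∈ , refl = subst (_∈ D) (sym (newEdge-id e∈)) e∈

    from : D ⊆D layers D col 0 ℓ
    from e∈ = subst (_∈ layers D col 0 ℓ) (newEdge-id e∈) (∈-layers⁺ D col e∈ (bound e∈))

  -- For `from`, the height h + `base` of D belongs to some edge u. By `newHeight-id` it is also the
  -- new height of u, and it lies in the range reserved for colour t. The ranges of different
  -- colours are disjoint, so u has colour t and its endpoint has rank h.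
  rel-cls-heights : ∀ t q h → (h ∈ heights (rel (cls D col t)) q) ⇔ (1 ≤ h × h ≤ pegCount (rel (cls D col t)) q)
  rel-cls-heights t q h = mk⇔ to from
    where
    X : Diagram
    X = cls D col t

    to : h ∈ heights (rel X) q → 1 ≤ h × h ≤ pegCount (rel X) q
    to h∈ with ∈-heights⁻ (rel X) h∈
    ... | e' , e'∈ , end' with ∈-map⁻ _ e'∈
    ...   | e , e∈ , refl with EndAt-raise⁻ (rank X) e end'
    ...     | h₀ , end , refl =
      s≤s z≤n , subst (rank X q h₀ ≤_) (sym (pegCount-rel X q)) (rank-≤ X q (∈-heights⁺ e∈ end))

    top : h ≤ pegCount (rel X) q → h + base D col t q ≤ base D col (suc t) q
    top h≤ = begin
      h + base D col t q            ≤⟨ ℕ.+-monoˡ-≤ (base D col t q) (subst (h ≤_) (pegCount-rel X q) h≤) ⟩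
      pegCount X q + base D col t q ≡⟨ ℕ.+-comm (pegCount X q) (base D col t q) ⟩
      base D col t q + pegCount X q ≡⟨ base-suc D col t q ⟨
      base D col (suc t) q          ∎
      where open ℕ.≤-Reasoning

    from : 1 ≤ h × h ≤ pegCount (rel X) q → h ∈ heights (rel X) q
    from (1≤h , h≤) with bounds⇒heights web {q} {h + base D col t q} (ℕ.≤-trans 1≤h (ℕ.m≤m+n h _))
                           (ℕ.≤-trans (top h≤) (pegCount-filter-≤ (λ e → col e <? suc t) D q))
    ... | u , u∈ , end with newHeight-id u∈ end | ℕ.<-cmp (col u) t
    ...   | eq | tri< lt _ _ = contradiction eq (ℕ.<⇒≢ (begin-strict
        newHeight D col (col u) q (h + base D col t q) ≤⟨ newHeight-≤-base D col u∈ end ⟩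
        base D col (suc (col u)) q                     ≤⟨ base-mono D col lt q ⟩
        base D col t q                                 <⟨ ℕ.+-monoˡ-≤ (base D col t q) 1≤h ⟩
        h + base D col t q                             ∎))
        where open ℕ.≤-Reasoning
    ...   | eq | tri> _ _ gt = contradiction (sym eq) (ℕ.<⇒≢ (begin-strict
        h + base D col t q                             ≤⟨ top h≤ ⟩
        base D col (suc t) q                           ≤⟨ base-mono D col gt q ⟩
        base D col (col u) q                           <⟨ s≤s (ℕ.m≤n+m _ _) ⟩
        newHeight D col (col u) q (h + base D col t q) ∎))
        where open ℕ.≤-Reasoning
    ...   | eq | tri≈ _ refl _ = subst (_∈ heights (rel X) q) (ℕ.+-cancelʳ-≡ (base D col t q) _ h eq)
      (∈-heights⁺ (∈-map⁺ _ (∈-filter⁺ (λ e → col e ≟ t) u∈ refl)) (EndAt-raise⁺ (rank X) u end))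

  rel-cls-web : ∀ t → IsWeb n (rel (cls D col t))
  rel-cls-web t = unique , All.tabulate bounds , rel-cls-heights t
    where
    X : Diagram
    X = cls D col t

    reshift : Edge → Edge
    reshift = raise (λ q h → h + base D col t q)

    -- Relabelling must not merge edges: lifting by `base` undoes it, because `newEdge` fixes the
    -- edges of D.
    reshift-rel : map reshift (rel X) ≡ X
    reshift-rel = trans (sym (List.map-∘ X)) (List.map-id-local (All.tabulate λ {e} e∈ → lemma e∈))
      where
      lemma : ∀ {e} → e ∈ X → reshift (raise (rank X) e) ≡ e
      lemma e∈ with ∈-filter⁻ (λ e → col e ≟ t) {xs = D} e∈
      ... | e∈D , refl = newEdge-id e∈D

    unique : Unique (rel X)
    unique = Unique.map⁻ (subst Unique (sym reshift-rel) (Unique.filter⁺ (λ e → col e ≟ t) (proj₁ web)))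

    bounds : ∀ {e} → e ∈ rel X → _
    bounds e'∈ with ∈-map⁻ _ e'∈
    ... | e , e∈ , refl with All.lookup (proj₁ (proj₂ web)) (proj₁ (∈-filter⁻ (λ e → col e ≟ t) {xs = D} e∈))
    ...   | 1≤x , x<y , y≤n , _ = 1≤x , x<y , y≤n , s≤s z≤n , s≤s z≤n

threshold : ℕ → ℕ → ℕ
threshold m x = if ⌊ m ≤? x ⌋ then 1 else 0

threshold-mono : ∀ m {x y} → x ≤ y → threshold m x ≤ threshold m y
threshold-mono m {x} {y} x≤y with m ≤? x | m ≤? y
... | yes p | yes _ = ℕ.≤-refl
... | yes p | no ¬p = contradiction (ℕ.≤-trans p x≤y) ¬p
... | no _ | _ = z≤n

threshold-< : ∀ m {x} → x < m → threshold m x ≡ 0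
threshold-< m {x} x<m with m ≤? x
... | yes p = contradiction p (ℕ.<⇒≱ x<m)
... | no _ = refl

threshold-≥ : ∀ m {x} → m ≤ x → threshold m x ≡ 1
threshold-≥ m {x} m≤x with m ≤? x
... | yes p = refl
... | no ¬p = contradiction m≤x ¬p

threshold≤1 : ∀ m x → threshold m x < 2
threshold≤1 m x with m ≤? x
... | yes _ = ℕ.≤-refl
... | no _ = s≤s z≤n

∈⇒≢[] : ∀ {A : Set} {x : A} {xs} → x ∈ xs → xs ≢ []
∈⇒≢[] (here _) ()
∈⇒≢[] (there _) ()

-- Otherwise a threshold between two values of g would split E into a lower and an upper part.
indecomposable⇒constant : ∀ {n E} → IsWeb n E → Indecomposable n E → {g : Edge → ℕ} → Monotone E g →
  ∀ {u v} → u ∈ E → v ∈ E → g u ≡ g v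
indecomposable⇒constant {n} {E} web (_ , indec) {g} mono {u} {v} u∈ v∈ =
  ℕ.≤-antisym (ℕ.≮⇒≥ (¬< v∈ u∈)) (ℕ.≮⇒≥ (¬< u∈ v∈))
  where
  ¬< : ∀ {u v} → u ∈ E → v ∈ E → ¬ (g u < g v)
  ¬< {u} {v} u∈ v∈ lt = indec
    (rel (cls E col 0) , rel (cls E col 1) , rel-cls-web web col-mono 0 , rel-cls-web web col-mono 1 ,
     ∈⇒≢[] (∈-map⁺ _ (∈-filter⁺ (λ e → col e ≟ 0) u∈ (threshold-< (g v) lt))) ,
     ∈⇒≢[] (∈-map⁺ _ (∈-filter⁺ (λ e → col e ≟ 1) v∈ (threshold-≥ (g v) ℕ.≤-refl))) ,
     -- `layers` ends with the summand `[]`, which is stripped here to leave a sum of two parts.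
     subst (λ X → E ≈D (rel (cls E col 0) ⊕ X)) (List.++-identityʳ (rel (cls E col 1)))
       (proj₂ E≈ , proj₁ E≈))
    where
    col : Edge → ℕ
    col e = threshold (g v) (g e)

    col-mono : Monotone E col
    col-mono u∈ v∈ eu ev lt = threshold-mono (g v) (mono u∈ v∈ eu ev lt)

    E≈ : layers E col 0 2 ≈D E
    E≈ = layers-id web col-mono {2} (λ {e} _ → threshold≤1 (g v) (g e))

-- Finite choice: decidable equality of edges turns a relation that is total on a list into a
-- function. The given element of B is the value off the list.
choose : ∀ {B : Set} → B → {R : Edge → B → Set} (xs : List Edge) → (∀ {e} → e ∈ xs → ∃ (R e)) →
  Σ[ f ∈ (Edge → B) ] (∀ {e} → e ∈ xs → R e (f e))
choose b [] total = (λ _ → b) , λ ()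
choose {B} b {R} (x ∷ xs) total with choose b {R} xs (total ∘ there) | total (here refl)
... | f , f-ok | b₀ , r₀ = update , update-ok
  where
  update : Edge → B
  update e = if ⌊ e ≟E x ⌋ then b₀ else f e

  update-ok : ∀ {e} → e ∈ x ∷ xs → R e (update e)
  update-ok {e} e∈ with e ≟E x
  ... | yes refl = r₀
  update-ok (here refl) | no e≢x = contradiction refl e≢x
  update-ok (there e∈)  | no e≢x = f-ok e∈

-- The quantities to be shown constant are read off at a preimage under φ; stating them as a
-- relation G spares the construction of an inverse.
indecomposable⇒constant-rel : ∀ {n E} → IsWeb n E → Indecomposable n E → (G : Edge → ℕ → Set) →
  (∀ {u} → u ∈ E → ∃ (G u)) →
  (∀ {u v q h h' m m'} → u ∈ E → v ∈ E → EndAt u q h → EndAt v q h' → h < h' → G u m → G v m' → m ≤ m') →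
  (∀ {u m m'} → u ∈ E → G u m → G u m' → m ≡ m') →
  ∀ {u v m m'} → u ∈ E → v ∈ E → G u m → G v m' → m ≡ m'
indecomposable⇒constant-rel {E = E} web indec G total mono functional u∈ v∈ Gu Gv with choose 0 {G} E total
... | g , g-ok = trans (functional u∈ Gu (g-ok u∈)) (trans
  (indecomposable⇒constant web indec {g} (λ u∈ v∈ eu ev lt → mono u∈ v∈ eu ev lt (g-ok u∈) (g-ok v∈)) u∈ v∈)
  (functional v∈ (g-ok v∈) Gv))

-- Colouring edges instead of positions, since φ and the copies speak of edges. The default 0 is
-- reached only by edges outside D.
colourOf : ∀ {ℓ} (D : Diagram) → Colouring ℓ D → Edge → ℕ
colourOf [] [] e = 0
colourOf (x ∷ D) (t ∷ c) e = if ⌊ e ≟E x ⌋ then toℕ t else colourOf D c e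

Agrees : ∀ {ℓ} (D : Diagram) → Colouring ℓ D → (Edge → ℕ) → Set
Agrees D c col = ∀ j → col (lookup D j) ≡ toℕ (Vec.lookup c j)

colourOf-agrees : ∀ {ℓ D} → Unique D → (c : Colouring ℓ D) → Agrees D c (colourOf D c)
colourOf-agrees {D = x ∷ D} (x∉ ∷ uniq) (t ∷ c) Fin.zero with x ≟E x
... | yes _ = refl
... | no x≢x = contradiction refl x≢x
colourOf-agrees {D = x ∷ D} (x∉ ∷ uniq) (t ∷ c) (Fin.suc j) with lookup D j ≟E x
... | yes eq = contradiction (sym eq) (All.lookup x∉ (∈-lookup j))
... | no _ = colourOf-agrees uniq c j

agrees-< : ∀ {ℓ D col} (c : Colouring ℓ D) → Agrees D c col → ∀ {e} → e ∈ D → col e < ℓ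
agrees-< {ℓ} {D} {col} c agrees e∈ = subst (λ e → col e < ℓ) (sym (lookup-index e∈))
  (subst (_< ℓ) (sym (agrees (Any.index e∈))) (Fin.toℕ<n (Vec.lookup c (Any.index e∈))))

classOf≡cls : ∀ {ℓ} D (c : Colouring ℓ D) col → Agrees D c col → ∀ t → classOf D c t ≡ cls D col (toℕ t)
classOf≡cls [] [] col agrees t = refl
classOf≡cls (e ∷ D) (s ∷ c) col agrees t with s Fin.≟ t
... | yes refl = trans (cong (e ∷_) (classOf≡cls D c col (agrees ∘ Fin.suc) t))
  (sym (List.filter-accept (λ e → col e ≟ toℕ t) (agrees Fin.zero)))
... | no s≢t = trans (classOf≡cls D c col (agrees ∘ Fin.suc) t)
  (sym (List.filter-reject (λ e → col e ≟ toℕ t) (λ eq → s≢t (Fin.toℕ-injective (trans (sym (agrees Fin.zero)) eq)))))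

⨁-tabulate≡layers : ∀ D col s r → ⨁ (tabulate {n = r} (λ t → rel (cls D col (s + toℕ t)))) ≡ layers D col s r
⨁-tabulate≡layers D col s zero = refl
⨁-tabulate≡layers D col s (suc r) = cong₂ _⊕_ (cong layer (ℕ.+-identityʳ s)) (begin
  ⨁ (tabulate {n = r} (λ t → layer (s + suc (toℕ t))))
    ≡⟨ cong ⨁ (List.tabulate-cong {n = r} (λ t → cong layer (ℕ.+-suc s (toℕ t)))) ⟩
  ⨁ (tabulate {n = r} (λ t → layer (suc s + toℕ t)))
    ≡⟨ ⨁-tabulate≡layers D col (suc s) r ⟩
  layers D col (suc s) r ∎)
  where
  open ≡-Reasoning
  layer : ℕ → Diagram
  layer t = rel (cls D col t)

𝓡≡layers : ∀ {ℓ} D (c : Colouring ℓ D) col → Agrees D c col → 𝓡 D c ≡ layers D col 0 ℓ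
𝓡≡layers {ℓ} D c col agrees = trans
  (cong ⨁ (trans (List.map-tabulate id (λ t → rel (classOf D c t)))
    (List.tabulate-cong (λ t → cong rel (classOf≡cls D c col agrees t)))))
  (⨁-tabulate≡layers D col 0 ℓ)

-- Summands under a colouring with 𝓡(D,c) = D

-- Delete the partner y of the first entry x: injectivity keeps the partners of all later entries
-- away from y, so the induction goes on with one entry fewer on both sides.
injection⇒length-≤ : ∀ {A B : Set} (R : A → B → Set) {xs : List A} {ys : List B} → Unique xs →
  (∀ {x} → x ∈ xs → ∃[ y ] y ∈ ys × R x y) →
  (∀ {x x' y} → x ∈ xs → x' ∈ xs → R x y → R x' y → x ≡ x') →
  length xs ≤ length ys
injection⇒length-≤ R {[]} uniq total inj = z≤n
injection⇒length-≤ R {x ∷ xs} (x∉ ∷ uniq) total inj with total (here refl)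
... | y , y∈ , Rxy with ∈-∃++ y∈
...   | ys₁ , ys₂ , refl = subst (suc (length xs) ≤_)
  (trans (cong suc (List.length-++ ys₁)) (trans (sym (ℕ.+-suc (length ys₁) (length ys₂))) (sym (List.length-++ ys₁))))
  (s≤s (injection⇒length-≤ R uniq total' (λ p q → inj (there p) (there q))))
  where
  total' : ∀ {x'} → x' ∈ xs → ∃[ y' ] y' ∈ ys₁ ++ ys₂ × R x' y'
  total' x'∈ with total (there x'∈)
  ... | y' , y'∈ , Rx'y' with ∈-++⁻ ys₁ y'∈
  ...   | inj₁ p = y' , ∈-++⁺ˡ p , Rx'y'
  ...   | inj₂ (there p) = y' , ∈-++⁺ʳ ys₁ p , Rx'y'
  ...   | inj₂ (here refl) = contradiction (inj (here refl) (there x'∈) Rxy Rx'y') (All.lookup x∉ x'∈)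

-- If j and j' ≠ j had the same image, j' could be dropped and the other k - 1 elements would still
-- reach all k.
surjective⇒injective : ∀ {k} (R : Fin k → Fin k → Set) →
  (∀ i → ∃[ j ] R j i) → (∀ j → ∃[ i ] R j i) →
  (∀ {j i i'} → R j i → R j i' → i ≡ i') →
  ∀ {j j' i} → R j i → R j' i → j ≡ j'
surjective⇒injective {k} R surj total functional {j} {j'} {i} Rji Rj'i with j Fin.≟ j'
... | yes eq = eq
... | no j≢j' = contradiction
  (injection⇒length-≤ (λ i j → R j i) {allFin k} {ys} (Unique.allFin⁺ k) preimage (λ _ _ → functional))
  (ℕ.<⇒≱ (List.filter-notAll ≢j'? (allFin k) (lose (∈-allFin j') (λ ¬p → ¬p refl))))
  where
  ≢j'? : ∀ a → Dec (a ≢ j')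
  ≢j'? a = ¬? (a Fin.≟ j')

  ys : List (Fin k)
  ys = filter ≢j'? (allFin k)

  preimage : ∀ {i} → i ∈ allFin k → ∃[ j ] j ∈ ys × R j i
  preimage {i'} _ with surj i'
  ... | j″ , Rj″i' with j″ Fin.≟ j'
  ...   | no ≢ = j″ , ∈-filter⁺ ≢j'? (∈-allFin j″) ≢ , Rj″i'
  ...   | yes refl with functional Rj'i Rj″i'
  ...     | refl = j , ∈-filter⁺ ≢j'? (∈-allFin j) j≢j' , Rji

-- Copies of the summands in a direct sum

prefixCount : (Es : List Diagram) → Fin (length Es) → ℕ → ℕ
prefixCount Es i = pegCount (⨁ (take (toℕ i) Es))

addHeights : (ℕ → ℕ) → Edge → Edge
addHeights s = raise (λ q h → h + s q)

copyOf-zero : ∀ E Es → copyOf (E ∷ Es) Fin.zero ≡ E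
copyOf-zero E Es = trans (List.map-cong (λ e → raise-cong _ (λ _ h → h) e (λ {q} {h} _ → ℕ.+-identityʳ h)) E) (List.map-id E)

copyOf-suc : ∀ E Es i → copyOf (E ∷ Es) (Fin.suc i) ≡ shiftBy E (copyOf Es i)
copyOf-suc E Es i = trans
  (List.map-cong (λ e → raise-cong _ (λ q h → h + prefixCount Es i q + pegCount E q) e (λ {q} {h} _ → eq q h)) (lookup Es i))
  (List.map-∘ (lookup Es i))
  where
  eq : ∀ q h → h + pegCount (E ⊕ ⨁ (take (toℕ i) Es)) q ≡ h + prefixCount Es i q + pegCount E q
  eq q h = trans (cong (h +_) (trans (pegCount-⊕ E (⨁ (take (toℕ i) Es)) q) (ℕ.+-comm (pegCount E q) _)))
                 (sym (ℕ.+-assoc h _ _))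

∈-⨁⁻ : ∀ Es {e} → e ∈ ⨁ Es → ∃[ i ] e ∈ copyOf Es i
∈-⨁⁻ (E ∷ Es) {e} e∈ with ∈-++⁻ E e∈
... | inj₁ p = Fin.zero , subst (e ∈_) (sym (copyOf-zero E Es)) p
... | inj₂ p with ∈-map⁻ _ p
...   | e' , e'∈ , refl with ∈-⨁⁻ Es e'∈
...     | i , e'∈copy = Fin.suc i , subst (e ∈_) (sym (copyOf-suc E Es i)) (∈-map⁺ _ e'∈copy)

∈-⨁⁺ : ∀ Es i {e} → e ∈ copyOf Es i → e ∈ ⨁ Es
∈-⨁⁺ (E ∷ Es) Fin.zero e∈ = ∈-++⁺ˡ (subst (_ ∈_) (copyOf-zero E Es) e∈)
∈-⨁⁺ (E ∷ Es) (Fin.suc i) e∈ with ∈-map⁻ _ (subst (_ ∈_) (copyOf-suc E Es i) e∈)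
... | e' , e'∈ , refl = ∈-++⁺ʳ E (∈-map⁺ _ (∈-⨁⁺ Es i e'∈))

prefixCount-mono : ∀ Es {i j} q → i Fin.< j → prefixCount Es i q + pegCount (lookup Es i) q ≤ prefixCount Es j q
prefixCount-mono (E ∷ Es) {Fin.zero} {Fin.suc j} q _
  rewrite pegCount-⊕ E (⨁ (take (toℕ j) Es)) q = ℕ.m≤m+n _ _
prefixCount-mono (E ∷ Es) {Fin.suc i} {Fin.suc j} q (s≤s i<j)
  rewrite pegCount-⊕ E (⨁ (take (toℕ i) Es)) q | pegCount-⊕ E (⨁ (take (toℕ j) Es)) q
        | ℕ.+-assoc (pegCount E q) (prefixCount Es i q) (pegCount (lookup Es i) q)
  = ℕ.+-monoʳ-≤ (pegCount E q) (prefixCount-mono Es q i<j)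

recoloured : (ℕ → ℕ → ℕ → ℕ) → (Edge → ℕ) → Edge → Edge
recoloured nh col e = raise (nh (col e)) e

-- What is needed about the passage from D to 𝓡: endpoints are reordered on each
-- peg according to the lexicographic order on (colour , old height).
module LexicographicHeights (D : Diagram) (col : Edge → ℕ) (nh : ℕ → ℕ → ℕ → ℕ)
  (nh-mono-colour : ∀ {u q h t h'} → u ∈ D → EndAt u q h → col u < t → nh (col u) q h < nh t q h')
  (nh-mono-height : ∀ {u q h h'} → u ∈ D → EndAt u q h → h < h' → nh (col u) q h < nh (col u) q h')
  where

  φ : Edge → Edge
  φ = recoloured nh col

  nh-reflect : ∀ {u v q h h'} → u ∈ D → v ∈ D → EndAt u q h → EndAt v q h' →
    nh (col u) q h < nh (col v) q h' →
    col u < col v ⊎ (col u ≡ col v × h < h')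
  nh-reflect {u} {v} {q} {h} {h'} u∈ v∈ eu ev lt with ℕ.<-cmp (col u) (col v)
  ... | tri< p _ _ = inj₁ p
  ... | tri> _ _ p = contradiction (nh-mono-colour v∈ ev p) (ℕ.<-asym lt)
  ... | tri≈ _ eq _ with ℕ.<-cmp h h'
  ...   | tri< p _ _ = inj₂ (eq , p)
  ...   | tri≈ _ refl _ = contradiction lt (ℕ.<-irrefl (cong (λ t → nh t q h) eq))
  ...   | tri> _ _ p = contradiction
    (subst (λ t → nh (col v) q h' < nh t q h) (sym eq) (nh-mono-height v∈ ev p))
    (ℕ.<-asym lt)

  nh-injective : ∀ {u v q h h'} → u ∈ D → v ∈ D → EndAt u q h → EndAt v q h' →
    nh (col u) q h ≡ nh (col v) q h' → h ≡ h'
  nh-injective {u} {v} {q} {h} {h'} u∈ v∈ eu ev eq with ℕ.<-cmp (col u) (col v)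
  ... | tri< p _ _ = contradiction eq (ℕ.<⇒≢ (nh-mono-colour u∈ eu p))
  ... | tri> _ _ p = contradiction (sym eq) (ℕ.<⇒≢ (nh-mono-colour v∈ ev p))
  ... | tri≈ _ cu≡cv _ with ℕ.<-cmp h h'
  ...   | tri≈ _ refl _ = refl
  ...   | tri< p _ _ = contradiction eq
    (ℕ.<⇒≢ (subst (λ t → nh (col u) q h < nh t q h') cu≡cv (nh-mono-height u∈ eu p)))
  ...   | tri> _ _ p = contradiction (sym eq)
    (ℕ.<⇒≢ (subst (λ t → nh (col v) q h' < nh t q h) (sym cu≡cv) (nh-mono-height v∈ ev p)))

  φ-injective : ∀ {u v} → u ∈ D → v ∈ D → φ u ≡ φ v → u ≡ v
  φ-injective {x , y , a , b} {x' , y' , a' , b'} u∈ v∈ eq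
    with cong proj₁ eq | cong (proj₁ ∘ proj₂) eq
  ... | refl | refl = cong₂ (λ a b → x , y , a , b)
    (nh-injective u∈ v∈ (inj₁ (refl , refl)) (inj₁ (refl , refl)) (cong (proj₁ ∘ proj₂ ∘ proj₂) eq))
    (nh-injective u∈ v∈ (inj₂ (refl , refl)) (inj₂ (refl , refl)) (cong (proj₂ ∘ proj₂ ∘ proj₂) eq))

-- Order-isomorphic web diagrams

≢[]⇒∃ : ∀ {A : Set} {xs : List A} → xs ≢ [] → ∃[ x ] x ∈ xs
≢[]⇒∃ {xs = []} ≢[] = contradiction refl ≢[]
≢[]⇒∃ {xs = x ∷ xs} _ = x , here refl

-- Corresponding ends: left with left or right with right. Two separate `EndAt` would not say that
-- the same side of both edges is meant.
Ends : Edge → Edge → ℕ → ℕ → ℕ → Set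
Ends (x , y , a , b) (x' , y' , a' , b') q h h' =
  (x ≡ q × x' ≡ q × a ≡ h × a' ≡ h') ⊎ (y ≡ q × y' ≡ q × b ≡ h × b' ≡ h')

Ends⇒EndAt : ∀ e e' {q h h'} → Ends e e' q h h' → EndAt e q h × EndAt e' q h'
Ends⇒EndAt e e' (inj₁ (p , p' , r , r')) = inj₁ (p , r) , inj₁ (p' , r')
Ends⇒EndAt e e' (inj₂ (p , p' , r , r')) = inj₂ (p , r) , inj₂ (p' , r')

raise-Ends : ∀ α β e e' {q h h'} → raise α e ≡ raise β e' → Ends e e' q h h' → α q h ≡ β q h'
raise-Ends α β e e' eq (inj₁ (refl , p' , refl , refl)) =
  trans (cong (proj₁ ∘ proj₂ ∘ proj₂) eq) (cong (λ q → β q _) p')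
raise-Ends α β e e' eq (inj₂ (refl , p' , refl , refl)) =
  trans (cong (proj₂ ∘ proj₂ ∘ proj₂) eq) (cong (λ q → β q _) p')

module _ {n : ℕ} {A B : Diagram} (A-web : IsWeb n A) (B-web : IsWeb n B) (Match : Edge → Edge → Set)
  (match : ∀ {e} → e ∈ A → ∃[ e' ] e' ∈ B × Match e e')
  (comatch : ∀ {e'} → e' ∈ B → ∃[ e ] e ∈ A × Match e e')
  (same-pegs : ∀ {e e'} → Match e e' → proj₁ e ≡ proj₁ e' × proj₁ (proj₂ e) ≡ proj₁ (proj₂ e'))
  (mono : ∀ {e₁ e₁' e₂ e₂' q h₁ h₁' h₂ h₂'} → Match e₁ e₁' → Match e₂ e₂' →
    Ends e₁ e₁' q h₁ h₁' → Ends e₂ e₂' q h₂ h₂' → h₁ < h₂ → h₁' < h₂')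
  (comono : ∀ {e₁ e₁' e₂ e₂' q h₁ h₁' h₂ h₂'} → Match e₁ e₁' → Match e₂ e₂' →
    Ends e₁ e₁' q h₁ h₁' → Ends e₂ e₂' q h₂ h₂' → h₁' < h₂' → h₁ < h₂)
  where
  private
    F : ℕ → ℕ → ℕ → Set
    F q h h' = ∃[ e ] ∃[ e' ] e ∈ A × e' ∈ B × Match e e' × Ends e e' q h h'

    F-left : ∀ {e e'} → e ∈ A → e' ∈ B → Match e e' → F (proj₁ e) (proj₁ (proj₂ (proj₂ e))) (proj₁ (proj₂ (proj₂ e')))
    F-left e∈ e'∈ m = _ , _ , e∈ , e'∈ , m , inj₁ (refl , sym (proj₁ (same-pegs m)) , refl , refl)

    F-right : ∀ {e e'} → e ∈ A → e' ∈ B → Match e e' → F (proj₁ (proj₂ e)) (proj₂ (proj₂ (proj₂ e))) (proj₂ (proj₂ (proj₂ e')))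
    F-right e∈ e'∈ m = _ , _ , e∈ , e'∈ , m , inj₂ (refl , sym (proj₂ (same-pegs m)) , refl , refl)

    F-total : ∀ {q h} → 1 ≤ h → h ≤ pegCount A q → ∃[ h' ] F q h h'
    F-total 1≤h h≤p with bounds⇒heights A-web 1≤h h≤p
    ... | e , e∈ , inj₁ (refl , refl) with match e∈
    ...   | e' , e'∈ , m = _ , F-left e∈ e'∈ m
    F-total 1≤h h≤p | e , e∈ , inj₂ (refl , refl) with match e∈
    ...   | e' , e'∈ , m = _ , F-right e∈ e'∈ m

    F-cototal : ∀ {q h'} → 1 ≤ h' → h' ≤ pegCount B q → ∃[ h ] F q h h'
    F-cototal 1≤h h≤p with bounds⇒heights B-web 1≤h h≤p
    ... | e' , e'∈ , inj₁ (refl , refl) with comatch e'∈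
    ...   | e , e∈ , m = _ , subst (λ q → F q _ _) (proj₁ (same-pegs m)) (F-left e∈ e'∈ m)
    F-cototal 1≤h h≤p | e' , e'∈ , inj₂ (refl , refl) with comatch e'∈
    ...   | e , e∈ , m = _ , subst (λ q → F q _ _) (proj₂ (same-pegs m)) (F-right e∈ e'∈ m)

    F-bounds : ∀ {q h h'} → F q h h' → (1 ≤ h × h ≤ pegCount A q) × (1 ≤ h' × h' ≤ pegCount B q)
    F-bounds (e , e' , e∈ , e'∈ , _ , ends) with Ends⇒EndAt e e' ends
    ... | end , end' = heights⇒bounds A-web e∈ end , heights⇒bounds B-web e'∈ end'

    -- The correspondence is total and strictly increasing in both directions, so the bound from
    -- below applies to it and to its converse. Using that bound twice avoids comparing the peg
    -- counts of A and B.
    F-id : ∀ {q h h'} → F q h h' → h ≡ h'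
    F-id {q} {h} {h'} Fh = ℕ.≤-antisym
      (strictlyMonotone-lower (F q) F-total
        (λ { (_ , _ , _ , _ , m₁ , ends₁) (_ , _ , _ , _ , m₂ , ends₂) → mono m₁ m₂ ends₁ ends₂ })
        (proj₁ ∘ proj₂ ∘ F-bounds) h (proj₂ (proj₁ (F-bounds Fh))) Fh)
      (strictlyMonotone-lower (λ h h' → F q h' h) F-cototal
        (λ { (_ , _ , _ , _ , m₁ , ends₁) (_ , _ , _ , _ , m₂ , ends₂) → comono m₁ m₂ ends₁ ends₂ })
        (proj₁ ∘ proj₁ ∘ F-bounds) h' (proj₂ (proj₂ (F-bounds Fh))) Fh)

    match⇒≡ : ∀ {e e'} → e ∈ A → e' ∈ B → Match e e' → e ≡ e'
    match⇒≡ e∈ e'∈ m = cong₂ _,_ (proj₁ (same-pegs m)) (cong₂ _,_ (proj₂ (same-pegs m))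
      (cong₂ _,_ (F-id (F-left e∈ e'∈ m)) (F-id (F-right e∈ e'∈ m))))

  orderIsomorphic⇒≈ : A ≈D B
  orderIsomorphic⇒≈ = to , from
    where
    to : A ⊆D B
    to e∈ with match e∈
    ... | e' , e'∈ , m = subst (_∈ B) (sym (match⇒≡ e∈ e'∈ m)) e'∈

    from : B ⊆D A
    from e'∈ with comatch e'∈
    ... | e , e∈ , m = subst (_∈ A) (match⇒≡ e∈ e'∈ m) e∈

Induced : ∀ {ℓ k L} → (Fin L → Fin k) → Vec (Fin ℓ) L → (Fin k → ℕ) → Set
Induced owner c g = ∀ j → toℕ (Vec.lookup c j) ≡ g (owner j)

OrderPreserving : ∀ {k} → (Fin k → Fin k → Set) → (Fin k → ℕ) → Set
OrderPreserving Prec g = ∀ {i j} → Prec i j → g i ≤ g j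

-- Good colourings and order-preserving maps on the summands

module Summands {n k : ℕ} {D : Diagram} (web : IsWeb n D) (E : Fin k → Diagram) (S : Fin k → ℕ → ℕ)
  (summand-web : ∀ i → IsWeb n (E i)) (summand-indecomposable : ∀ i → Indecomposable n (E i))
  (S-mono : ∀ {i j} q → i Fin.< j → S i q + pegCount (E i) q ≤ S j q)
  (copy : Fin k → Diagram)
  (∈-copy⁺ : ∀ i {e} → e ∈ E i → addHeights (S i) e ∈ copy i)
  (∈-copy⁻ : ∀ i {e} → e ∈ copy i → ∃[ e₀ ] e₀ ∈ E i × e ≡ addHeights (S i) e₀)
  (copy-⊆ : ∀ i → copy i ⊆D D) (D⇒copy : ∀ {e} → e ∈ D → ∃[ i ] e ∈ copy i) where

  private
    shift : Fin k → Edge → Edge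
    shift i = addHeights (S i)

    copy⇒D : ∀ {i e} → e ∈ copy i → e ∈ D
    copy⇒D {i} e∈ = copy-⊆ i e∈

  copy-inhabited : ∀ i → ∃[ e ] e ∈ copy i
  copy-inhabited i with ≢[]⇒∃ (proj₁ (summand-indecomposable i))
  ... | e , e∈ = shift i e , ∈-copy⁺ i e∈

  copy-bounds : ∀ {i e q h} → e ∈ copy i → EndAt e q h → S i q < h × h ≤ S i q + pegCount (E i) q
  copy-bounds {i} {q = q} e∈ end with ∈-copy⁻ i e∈
  ... | e₀ , e₀∈ , refl with EndAt-raise⁻ _ e₀ end
  ...   | h₀ , end₀ , refl with heights⇒bounds (summand-web i) e₀∈ end₀
  ...     | 1≤h₀ , h₀≤p = ℕ.+-monoˡ-≤ (S i q) 1≤h₀ ,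
    subst (_≤ S i q + pegCount (E i) q) (ℕ.+-comm (S i q) h₀) (ℕ.+-monoʳ-≤ (S i q) h₀≤p)

  copy-below : ∀ {i j u v q h h'} → u ∈ copy i → v ∈ copy j → EndAt u q h → EndAt v q h' →
    i Fin.< j → h < h'
  copy-below {q = q} u∈ v∈ eu ev i<j = ℕ.≤-<-trans (proj₂ (copy-bounds u∈ eu))
    (ℕ.≤-<-trans (S-mono q i<j) (proj₁ (copy-bounds v∈ ev)))

  copy-order : ∀ {i j u v q h h'} → u ∈ copy i → v ∈ copy j → EndAt u q h → EndAt v q h' →
    h ≤ h' → i Fin.≤ j
  copy-order u∈ v∈ eu ev h≤h' = ℕ.≮⇒≥ λ j<i → ℕ.<⇒≱ (copy-below v∈ u∈ ev eu j<i) h≤h'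

  -- Compare the left end of e with itself, once in each direction.
  copy-unique : ∀ {i j e} → e ∈ copy i → e ∈ copy j → i ≡ j
  copy-unique p q = Fin.toℕ-injective (ℕ.≤-antisym
    (copy-order p q (inj₁ (refl , refl)) (inj₁ (refl , refl)) ℕ.≤-refl)
    (copy-order q p (inj₁ (refl , refl)) (inj₁ (refl , refl)) ℕ.≤-refl))

  -- Unfolds to `Gen Es` when `copy` is `copyOf Es`, so that results about it apply to the
  -- decomposition poset directly.
  Precedes : Fin k → Fin k → Set
  Precedes i j = (i Fin.< j) × ∃[ e ] ∃[ e' ] ∃[ q ] ∃[ h ] ∃[ h' ]
    (e ∈ copy i × e' ∈ copy j × EndAt e q h × EndAt e' q h' × h < h')

  Compatible : (Edge → ℕ) → Set
  Compatible col =
    (∀ {i u v} → u ∈ copy i → v ∈ copy i → col u ≡ col v) ×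
    (∀ {i j u v} → Precedes i j → u ∈ copy i → v ∈ copy j → col u ≤ col v)

  -- Of two endpoints on a peg, the lower one lies in the same copy, where the colour is constant,
  -- or in an earlier copy, and then the two endpoints witness `Precedes`.
  compatible⇒monotone : ∀ {col} → Compatible col → Monotone D col
  compatible⇒monotone (const , mono) {u} {v} {q} {h} {h'} u∈ v∈ eu ev lt with D⇒copy u∈ | D⇒copy v∈
  ... | i , u∈i | j , v∈j with ℕ.m≤n⇒m<n∨m≡n (copy-order u∈i v∈j eu ev (ℕ.<⇒≤ lt))
  ...   | inj₁ i<j = mono (i<j , u , v , q , h , h' , u∈i , v∈j , eu , ev , lt) u∈i v∈j
  ...   | inj₂ i≡j with Fin.toℕ-injective i≡j
  ...     | refl = ℕ.≤-reflexive (const u∈i v∈j)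

  module Recoloured (distinct : ∀ i j → i ≢ j → ¬ (E i ≈D E j)) (col : Edge → ℕ) (nh : ℕ → ℕ → ℕ → ℕ)
    (nh-mono-colour : ∀ {u q h t h'} → u ∈ D → EndAt u q h → col u < t → nh (col u) q h < nh t q h')
    (nh-mono-height : ∀ {u q h h'} → u ∈ D → EndAt u q h → h < h' → nh (col u) q h < nh (col u) q h')
    (φ-into : ∀ {e} → e ∈ D → recoloured nh col e ∈ D)
    (φ-onto : ∀ {e} → e ∈ D → ∃[ u ] u ∈ D × recoloured nh col u ≡ e) where

    open LexicographicHeights D col nh nh-mono-colour nh-mono-height

    φ-reflect : ∀ {u v q H H'} → u ∈ D → v ∈ D → EndAt (φ u) q H → EndAt (φ v) q H' → H < H' →
      ∃[ h ] ∃[ h' ] EndAt u q h × EndAt v q h' × (col u < col v ⊎ (col u ≡ col v × h < h'))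
    φ-reflect {u} {v} u∈ v∈ eu ev lt with EndAt-raise⁻ _ u eu | EndAt-raise⁻ _ v ev
    ... | h , eu' , refl | h' , ev' , refl = h , h' , eu' , ev' , nh-reflect u∈ v∈ eu' ev' lt

    shift∈D : ∀ {j e} → e ∈ E j → shift j e ∈ D
    shift∈D {j} e∈ = copy⇒D (∈-copy⁺ j e∈)

    -- A lower image has a smaller pair (colour, old height), hence a colour that is not larger. `G`
    -- gives an edge of `E j` the colour of the preimage of its shifted form; `φ-injective` makes
    -- this single-valued.
    same-φ-copy⇒same-colour : ∀ {j u v} → u ∈ D → v ∈ D → φ u ∈ copy j → φ v ∈ copy j → col u ≡ col v
    same-φ-copy⇒same-colour {j} {u} {v} u∈ v∈ φu∈ φv∈ with ∈-copy⁻ j φu∈ | ∈-copy⁻ j φv∈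
    ... | e , e∈ , φu≡ | e' , e'∈ , φv≡ = indecomposable⇒constant-rel (summand-web j) (summand-indecomposable j)
      G total mono functional e∈ e'∈ (u , u∈ , φu≡ , refl) (v , v∈ , φv≡ , refl)
      where
      G : Edge → ℕ → Set
      G e m = ∃[ u ] u ∈ D × φ u ≡ shift j e × m ≡ col u

      total : ∀ {e} → e ∈ E j → ∃ (G e)
      total e∈ with φ-onto (shift∈D e∈)
      ... | u , u∈ , eq = col u , u , u∈ , eq , refl

      mono : ∀ {e e' q h h' m m'} → e ∈ E j → e' ∈ E j → EndAt e q h → EndAt e' q h' → h < h' → G e m → G e' m' → m ≤ m'
      mono {e} {e'} {q} _ _ end end' lt (u , u∈ , eq , refl) (v , v∈ , eq' , refl)
        with φ-reflect u∈ v∈ (subst (λ z → EndAt z q _) (sym eq) (EndAt-raise⁺ (λ q h → h + S j q) e end))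
               (subst (λ z → EndAt z q _) (sym eq') (EndAt-raise⁺ (λ q h → h + S j q) e' end')) (ℕ.+-monoˡ-< (S j q) lt)
      ... | _ , _ , _ , _ , inj₁ lt' = ℕ.<⇒≤ lt'
      ... | _ , _ , _ , _ , inj₂ (eq″ , _) = ℕ.≤-reflexive eq″

      functional : ∀ {e m m'} → e ∈ E j → G e m → G e m' → m ≡ m'
      functional _ (u , u∈ , eq , refl) (v , v∈ , eq' , refl) =
        cong col (φ-injective u∈ v∈ (trans eq (sym eq')))

    -- By the previous lemma all preimages of copy j share one colour. A lower image then comes from
    -- a lower old height, and the old heights determine the order of the copies.
    same-φ-copy⇒same-copy : ∀ {j u v i i'} → u ∈ copy i → v ∈ copy i' →
      φ u ∈ copy j → φ v ∈ copy j → i ≡ i'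
    same-φ-copy⇒same-copy {j} {u} {v} {i} {i'} u∈ v∈ φu∈ φv∈ with ∈-copy⁻ j φu∈ | ∈-copy⁻ j φv∈
    ... | e , e∈ , φu≡ | e' , e'∈ , φv≡ = Fin.toℕ-injective
      (indecomposable⇒constant-rel (summand-web j) (summand-indecomposable j)
        G total mono functional e∈ e'∈ (u , i , u∈ , φu≡ , refl) (v , i' , v∈ , φv≡ , refl))
      where
      G : Edge → ℕ → Set
      G e m = ∃[ u ] ∃[ i ] u ∈ copy i × φ u ≡ shift j e × m ≡ toℕ i

      total : ∀ {e} → e ∈ E j → ∃ (G e)
      total e∈ with φ-onto (shift∈D e∈)
      ... | u , u∈ , eq with D⇒copy u∈
      ...   | i , u∈i = toℕ i , u , i , u∈i , eq , refl

      mono : ∀ {e e' q h h' m m'} → e ∈ E j → e' ∈ E j → EndAt e q h → EndAt e' q h' → h < h' → G e m → G e' m' → m ≤ m'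
      mono {e} {e'} {q} e∈ e'∈ end end' lt (u , i , u∈ , eq , refl) (v , i' , v∈ , eq' , refl)
        with φ-reflect (copy⇒D u∈) (copy⇒D v∈) (subst (λ z → EndAt z q _) (sym eq) (EndAt-raise⁺ (λ q h → h + S j q) e end))
               (subst (λ z → EndAt z q _) (sym eq') (EndAt-raise⁺ (λ q h → h + S j q) e' end')) (ℕ.+-monoˡ-< (S j q) lt)
      ... | _ , _ , _ , _ , inj₁ lt' = contradiction
        (same-φ-copy⇒same-colour (copy⇒D u∈) (copy⇒D v∈)
          (subst (_∈ copy j) (sym eq) (∈-copy⁺ j e∈)) (subst (_∈ copy j) (sym eq') (∈-copy⁺ j e'∈)))
        (ℕ.<⇒≢ lt')
      ... | _ , _ , eu , ev , inj₂ (_ , lt') = copy-order u∈ v∈ eu ev (ℕ.<⇒≤ lt')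

      functional : ∀ {e m m'} → e ∈ E j → G e m → G e m' → m ≡ m'
      functional _ (u , i , u∈ , eq , refl) (v , i' , v∈ , eq' , refl)
        with φ-injective (copy⇒D u∈) (copy⇒D v∈) (trans eq (sym eq'))
      ... | refl = cong toℕ (copy-unique u∈ v∈)

    φ-copy : ∀ {i u} → u ∈ copy i → ∃[ j ] φ u ∈ copy j
    φ-copy u∈ = D⇒copy (φ-into (copy⇒D u∈))

    -- Every j receives edges from only one i, and every i sends edges to some j. With k copies on
    -- both sides, no i can serve two different j.
    same-copy⇒same-φ-copy : ∀ {i u v j j'} → u ∈ copy i → v ∈ copy i →
      φ u ∈ copy j → φ v ∈ copy j' → j ≡ j'
    same-copy⇒same-φ-copy u∈ v∈ φu∈ φv∈ = surjective⇒injective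
      (λ j i → ∃[ u ] u ∈ copy i × φ u ∈ copy j) surj total
      (λ { (u , u∈ , φu∈) (v , v∈ , φv∈) → same-φ-copy⇒same-copy u∈ v∈ φu∈ φv∈ })
      (_ , u∈ , φu∈) (_ , v∈ , φv∈)
      where
      surj : ∀ i → ∃[ j ] ∃[ u ] u ∈ copy i × φ u ∈ copy j
      surj i with copy-inhabited i
      ... | u , u∈ with φ-copy u∈
      ...   | j , φu∈ = j , u , u∈ , φu∈

      total : ∀ j → ∃[ i ] ∃[ u ] u ∈ copy i × φ u ∈ copy j
      total j with copy-inhabited j
      ... | e , e∈ with φ-onto (copy⇒D e∈)
      ...   | u , u∈ , refl with D⇒copy u∈
      ...     | i , u∈i = i , u , u∈i , e∈

    same-copy⇒same-colour : ∀ {i u v} → u ∈ copy i → v ∈ copy i → col u ≡ col v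
    same-copy⇒same-colour {i} {u} {v} u∈ v∈ with φ-copy u∈ | φ-copy v∈
    ... | j , φu∈ | j' , φv∈ = same-φ-copy⇒same-colour (copy⇒D u∈) (copy⇒D v∈) φu∈
      (subst (λ j → φ v ∈ copy j) (sym (same-copy⇒same-φ-copy u∈ v∈ φu∈ φv∈)) φv∈)

    preimage-in-copy : ∀ {i j w e} → w ∈ copy i → φ w ∈ copy j → e ∈ copy j → ∃[ u ] u ∈ copy i × φ u ≡ e
    preimage-in-copy {i} {j} {w} {e} w∈ φw∈ e∈ = u , u∈i , φu≡e
      where
      u : Edge
      u = proj₁ (φ-onto (copy⇒D {j} e∈))

      u∈ : u ∈ D
      u∈ = proj₁ (proj₂ (φ-onto (copy⇒D {j} e∈)))

      φu≡e : φ u ≡ e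
      φu≡e = proj₂ (proj₂ (φ-onto (copy⇒D {j} e∈)))

      φu∈ : φ u ∈ copy j
      φu∈ = subst (λ z → z ∈ copy j) (sym φu≡e) e∈

      u∈i : u ∈ copy i
      u∈i = subst (λ i → u ∈ copy i)
        (sym (same-φ-copy⇒same-copy {j} {w} {u} {i} {proj₁ (D⇒copy u∈)} w∈ (proj₂ (D⇒copy u∈)) φw∈ φu∈)) (proj₂ (D⇒copy u∈))

    -- On copy i the colour is constant, so `nh` there compares old heights only. The shifts by
    -- `S i` and `S j` cancel, and what remains is an order isomorphism between the unshifted
    -- summands.
    summands≈ : ∀ {i j w} → w ∈ copy i → φ w ∈ copy j → E i ≈D E j
    summands≈ {i} {j} {w} w∈ φw∈ = orderIsomorphic⇒≈ (summand-web i) (summand-web j) Match match comatch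
      (λ (_ , _ , eq) → cong proj₁ eq , cong (proj₁ ∘ proj₂) eq) mono comono
      where
      Match : Edge → Edge → Set
      Match e e' = e ∈ E i × e' ∈ E j × φ (shift i e) ≡ shift j e'

      match : ∀ {e} → e ∈ E i → ∃[ e' ] e' ∈ E j × Match e e'
      match {e} e∈ with φ-copy {i} (∈-copy⁺ i e∈)
      ... | j' , φe∈ with ∈-copy⁻ j (subst (λ j → φ (shift i e) ∈ copy j)
                            (sym (same-copy⇒same-φ-copy {i} w∈ (∈-copy⁺ i e∈) φw∈ φe∈)) φe∈)
      ...   | e' , e'∈ , eq = e' , e'∈ , e∈ , e'∈ , eq

      comatch : ∀ {e'} → e' ∈ E j → ∃[ e ] e ∈ E i × Match e e'
      comatch {e'} e'∈ =
        let u , u∈ , φu≡ = preimage-in-copy {i} {j} {w} {shift j e'} w∈ φw∈ (∈-copy⁺ j {e'} e'∈)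
            e , e∈ , u≡ = ∈-copy⁻ i {u} u∈
        in e , e∈ , e∈ , e'∈ , trans (cong φ (sym u≡)) φu≡

      same : ∀ {e₁ e₂} → e₁ ∈ E i → e₂ ∈ E i → col (shift i e₁) ≡ col (shift i e₂)
      same e₁∈ e₂∈ = same-copy⇒same-colour {i} (∈-copy⁺ i e₁∈) (∈-copy⁺ i e₂∈)

      moved : ∀ e e' {q h h'} → φ (shift i e) ≡ shift j e' → Ends e e' q h h' →
        nh (col (shift i e)) q (h + S i q) ≡ h' + S j q
      moved e e' = raise-Ends (λ q h → nh (col (shift i e)) q (h + S i q)) (λ q h → h + S j q) e e'

      mono : ∀ {e₁ e₁' e₂ e₂' q h₁ h₁' h₂ h₂'} → Match e₁ e₁' → Match e₂ e₂' →
        Ends e₁ e₁' q h₁ h₁' → Ends e₂ e₂' q h₂ h₂' → h₁ < h₂ → h₁' < h₂'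
      mono {e₁} {e₁'} {e₂} {e₂'} {q} {h₁} {h₁'} {h₂} {h₂'} (e₁∈ , _ , eq₁) (e₂∈ , _ , eq₂) ends₁ ends₂ lt =
        ℕ.+-cancelʳ-< (S j q) h₁' h₂' (subst₂ _<_ (moved e₁ e₁' eq₁ ends₁)
          (trans (cong (λ t → nh t q (h₂ + S i q)) (same e₁∈ e₂∈)) (moved e₂ e₂' eq₂ ends₂))
          (nh-mono-height (shift∈D {i} e₁∈) (EndAt-raise⁺ (λ q h → h + S i q) e₁ (proj₁ (Ends⇒EndAt e₁ e₁' ends₁))) (ℕ.+-monoˡ-< (S i q) lt)))

      comono : ∀ {e₁ e₁' e₂ e₂' q h₁ h₁' h₂ h₂'} → Match e₁ e₁' → Match e₂ e₂' →
        Ends e₁ e₁' q h₁ h₁' → Ends e₂ e₂' q h₂ h₂' → h₁' < h₂' → h₁ < h₂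
      comono {e₁} {e₁'} {e₂} {e₂'} {q} {h₁} {h₁'} {h₂} {h₂'} (e₁∈ , _ , eq₁) (e₂∈ , _ , eq₂) ends₁ ends₂ lt
        with nh-reflect (shift∈D {i} e₁∈) (shift∈D {i} e₂∈)
               (EndAt-raise⁺ (λ q h → h + S i q) e₁ (proj₁ (Ends⇒EndAt e₁ e₁' ends₁))) (EndAt-raise⁺ (λ q h → h + S i q) e₂ (proj₁ (Ends⇒EndAt e₂ e₂' ends₂)))
               (subst₂ _<_ (sym (moved e₁ e₁' eq₁ ends₁)) (sym (moved e₂ e₂' eq₂ ends₂)) (ℕ.+-monoˡ-< (S j q) lt))
      ... | inj₁ lt' = contradiction (same e₁∈ e₂∈) (ℕ.<⇒≢ lt')
      ... | inj₂ (_ , lt') = ℕ.+-cancelʳ-< (S i q) h₁ h₂ lt'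

    -- Equal summands are what would let φ interchange copies; `distinct` excludes this.
    φ-preserves-copy : ∀ {i u} → u ∈ copy i → φ u ∈ copy i
    φ-preserves-copy {i} {u} u∈ with φ-copy u∈
    ... | j , φu∈ with i Fin.≟ j
    ...   | yes refl = φu∈
    ...   | no i≢j = contradiction (summands≈ u∈ φu∈) (distinct i j i≢j)

    compatible : Compatible col
    compatible = same-copy⇒same-colour , mono
      where
      mono : ∀ {i j u v} → Precedes i j → u ∈ copy i → v ∈ copy j → col u ≤ col v
      mono {i} {j} {u} {v} (i<j , e , e' , q , h , h' , e∈ , e'∈ , end , end' , h<h') u∈ v∈ =
        subst₂ _≤_ (same-copy⇒same-colour e∈ u∈) (same-copy⇒same-colour e'∈ v∈)
          -- If e' had the smaller colour, φ would place it below e on peg q. But φ keeps both edges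
          -- in their copies, and copy i is below copy j.
          (ℕ.≮⇒≥ λ lt → ℕ.<-asym
            (nh-mono-colour (copy⇒D e'∈) end' lt)
            (copy-below (φ-preserves-copy e∈) (φ-preserves-copy e'∈) (EndAt-raise⁺ (nh (col e)) e end) (EndAt-raise⁺ (nh (col e')) e' end') i<j))

  owner : Fin (length D) → Fin k
  owner j = proj₁ (D⇒copy (∈-lookup j))

  owner-∈ : ∀ j → lookup D j ∈ copy (owner j)
  owner-∈ j = proj₂ (D⇒copy (∈-lookup j))

  owner-unique : ∀ j {i} → lookup D j ∈ copy i → owner j ≡ i
  owner-unique j e∈ = copy-unique (owner-∈ j) e∈

  member : ∀ i → ∃[ j ] owner j ≡ i
  member i =
    let e , e∈ = copy-inhabited i
        e∈D = copy-⊆ i e∈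
    in Any.index e∈D , owner-unique (Any.index e∈D) {i} (subst (λ e → e ∈ copy i) (lookup-index e∈D) e∈)

  position : ∀ {e} → e ∈ D → ∃[ j ] lookup D j ≡ e
  position e∈ = Any.index e∈ , sym (lookup-index e∈)

  -- Each summand owns an edge. This places the polynomials, of degree at most k, within the range ℓ
  -- ≤ |D| over which `Rval` sums.
  k≤length : k ≤ length D
  k≤length = subst₂ _≤_ (List.length-tabulate id) (List.length-tabulate id)
    (injection⇒length-≤ (λ i j → owner j ≡ i) {allFin k} {allFin (length D)} (Unique.allFin⁺ k)
      (λ {i} _ → proj₁ (member i) , ∈-allFin _ , proj₂ (member i)) (λ _ _ p q → trans (sym p) q))

  good⇒induced : (∀ i j → i ≢ j → ¬ (E i ≈D E j)) → ∀ {ℓ} (c : Colouring ℓ D) → 𝓡 D c ≈D D → ∃[ g ] Induced owner c g × OrderPreserving Precedes g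
  good⇒induced distinct {ℓ} c (𝓡⊆ , ⊆𝓡) = g , induced , preserving
    where
    col : Edge → ℕ
    col = colourOf D c

    agrees : Agrees D c col
    agrees = colourOf-agrees (proj₁ web) c

    into : ∀ {e} → e ∈ D → newEdge D col e ∈ D
    into {e} e∈ = 𝓡⊆ (subst (λ X → newEdge D col e ∈ X) (sym (𝓡≡layers D c col agrees)) (∈-layers⁺ D col e∈ (agrees-< c agrees e∈)))

    onto : ∀ {e} → e ∈ D → ∃[ u ] u ∈ D × newEdge D col u ≡ e
    onto {e} e∈ = let u , u∈ , eq = ∈-layers⁻ D col {ℓ} (subst (λ X → e ∈ X) (𝓡≡layers D c col agrees) (⊆𝓡 e∈))
              in u , u∈ , sym eq

    compat : Compatible col
    compat = Recoloured.compatible distinct col (newHeight D col)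
      (newHeight-mono-colour D col) (newHeight-mono-height D col) into onto

    g : Fin k → ℕ
    g i = col (proj₁ (copy-inhabited i))

    induced : Induced owner c g
    induced j = trans (sym (agrees j)) (proj₁ compat (owner-∈ j) (proj₂ (copy-inhabited (owner j))))

    preserving : OrderPreserving Precedes g
    preserving {i} {j} i≺j = proj₂ compat i≺j (proj₂ (copy-inhabited i)) (proj₂ (copy-inhabited j))

  induced⇒good : ∀ {ℓ} (c : Colouring ℓ D) g → Induced owner c g → OrderPreserving Precedes g → 𝓡 D c ≈D D
  induced⇒good {ℓ} c g induced preserving = subst (_≈D D) (sym (𝓡≡layers D c col agrees))
    (layers-id web (compatible⇒monotone (const , mono)) (agrees-< c agrees))
    where
    col : Edge → ℕ
    col = colourOf D c

    agrees : Agrees D c col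
    agrees = colourOf-agrees (proj₁ web) c

    col≡g : ∀ {i e} → e ∈ copy i → col e ≡ g i
    col≡g {i} e∈ with position (copy-⊆ i e∈)
    ... | j , refl = trans (agrees j) (trans (induced j) (cong g (owner-unique j e∈)))

    const : ∀ {i u v} → u ∈ copy i → v ∈ copy i → col u ≡ col v
    const u∈ v∈ = trans (col≡g u∈) (sym (col≡g v∈))

    mono : ∀ {i j u v} → Precedes i j → u ∈ copy i → v ∈ copy j → col u ≤ col v
    mono i≺j u∈ v∈ = subst₂ _≤_ (sym (col≡g u∈)) (sym (col≡g v∈)) (preserving i≺j)

-- Sorted permutations and their words

∈ᵛ⇒lookup : ∀ {A : Set} {m x} {xs : Vec A m} → x ∈ᵛ xs → ∃[ s ] Vec.lookup xs s ≡ x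
∈ᵛ⇒lookup (hereᵛ refl) = Fin.zero , refl
∈ᵛ⇒lookup (thereᵛ p) with ∈ᵛ⇒lookup p
... | s , eq = Fin.suc s , eq

lookup-ext : ∀ {A : Set} {m} {xs ys : Vec A m} → (∀ s → Vec.lookup xs s ≡ Vec.lookup ys s) → xs ≡ ys
lookup-ext {xs = xs} {ys} eq = trans (sym (Vec.tabulate∘lookup xs)) (trans (Vec.tabulate-cong eq) (Vec.tabulate∘lookup ys))

module _ {k : ℕ} (g : Fin k → ℕ) where

  Lex : Fin k → Fin k → Set
  Lex a b = g a < g b ⊎ (g a ≡ g b × a Fin.< b)

  Lex⇒≤ : ∀ {a b} → Lex a b → g a ≤ g b
  Lex⇒≤ (inj₁ lt) = ℕ.<⇒≤ lt
  Lex⇒≤ (inj₂ (eq , _)) = ℕ.≤-reflexive eq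

  Lex-trans : ∀ {a b c} → Lex a b → Lex b c → Lex a c
  Lex-trans (inj₁ p) q = inj₁ (ℕ.<-≤-trans p (Lex⇒≤ q))
  Lex-trans (inj₂ (p , _)) (inj₁ q) = inj₁ (ℕ.≤-<-trans (ℕ.≤-reflexive p) q)
  Lex-trans (inj₂ (p , p')) (inj₂ (q , q')) = inj₂ (trans p q , ℕ.<-trans p' q')

  Lex-irrefl : ∀ {a} → ¬ Lex a a
  Lex-irrefl (inj₁ p) = ℕ.<-irrefl refl p
  Lex-irrefl (inj₂ (_ , p)) = ℕ.<-irrefl refl p

  Lex-asym : ∀ {a b} → Lex a b → ¬ Lex b a
  Lex-asym p q = Lex-irrefl (Lex-trans p q)

  Lex-connex : ∀ a b → a ≢ b → Lex a b ⊎ Lex b a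
  Lex-connex a b a≢b with ℕ.<-cmp (g a) (g b)
  ... | tri< p _ _ = inj₁ (inj₁ p)
  ... | tri> _ _ p = inj₂ (inj₁ p)
  ... | tri≈ _ eq _ with ℕ.<-cmp (toℕ a) (toℕ b)
  ...   | tri< p _ _ = inj₁ (inj₂ (eq , p))
  ...   | tri> _ _ p = inj₂ (inj₂ (sym eq , p))
  ...   | tri≈ _ p _ = contradiction (Fin.toℕ-injective p) a≢b

  Sorted : ∀ {m} → Vec (Fin k) m → Set
  Sorted [] = ⊤
  Sorted (a ∷ π) = (∀ {b} → b ∈ᵛ π → Lex a b) × Sorted π

  sorted-lookup : ∀ {m} (π : Vec (Fin k) m) → Sorted π → ∀ {s t} → s Fin.< t → Lex (Vec.lookup π s) (Vec.lookup π t)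
  sorted-lookup (a ∷ π) (a< , _) {Fin.zero} {Fin.suc t} _ = a< (∈ᵛ-lookup t π)
  sorted-lookup (a ∷ π) (_ , ok) {Fin.suc s} {Fin.suc t} (s≤s s<t) = sorted-lookup π ok s<t

  -- Both heads are the `Lex`-least element of the same set. `Lex` is irreflexive, so a head does
  -- not recur in its tail and the tails again have the same entries.
  sorted-unique : ∀ {m} (π π' : Vec (Fin k) m) → Sorted π → Sorted π' →
    (∀ {x} → x ∈ᵛ π → x ∈ᵛ π') → (∀ {x} → x ∈ᵛ π' → x ∈ᵛ π) → π ≡ π'
  sorted-unique [] [] _ _ _ _ = refl
  sorted-unique (a ∷ π) (a' ∷ π') (a< , ok) (a'< , ok') to from = cong₂ _∷_ a≡a'
    (sorted-unique π π' ok ok' (tail a≡a' a< to) (tail (sym a≡a') a'< from))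
    where
    heads : a ∈ᵛ a' ∷ π' → a' ∈ᵛ a ∷ π → a ≡ a'
    heads (hereᵛ eq) _ = eq
    heads (thereᵛ _) (hereᵛ eq) = sym eq
    heads (thereᵛ p) (thereᵛ q) = contradiction (a< q) (Lex-asym (a'< p))

    a≡a' : a ≡ a'
    a≡a' = heads (to (hereᵛ refl)) (from (hereᵛ refl))

    tail : ∀ {m} {b b'} {ρ ρ' : Vec (Fin k) m} → b ≡ b' → (∀ {c} → c ∈ᵛ ρ → Lex b c) →
      (∀ {x} → x ∈ᵛ b ∷ ρ → x ∈ᵛ b' ∷ ρ') → ∀ {x} → x ∈ᵛ ρ → x ∈ᵛ ρ'
    tail refl b< sub x∈ with sub (thereᵛ x∈)
    ... | hereᵛ refl = contradiction (b< x∈) Lex-irrefl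
    ... | thereᵛ p = p

  Lex? : ∀ a b → Dec (Lex a b)
  Lex? a b with a Fin.≟ b
  ... | yes refl = no Lex-irrefl
  ... | no a≢b with Lex-connex a b a≢b
  ...   | inj₁ p = yes p
  ...   | inj₂ q = no (Lex-asym q)

  insert : ∀ {m} → Fin k → Vec (Fin k) m → Vec (Fin k) (suc m)
  insert a [] = a ∷ []
  insert a (b ∷ π) = if ⌊ Lex? a b ⌋ then a ∷ b ∷ π else b ∷ insert a π

  ∈-insert⁺ : ∀ {m} a (π : Vec (Fin k) m) → a ∈ᵛ insert a π
  ∈-insert⁺ a [] = hereᵛ refl
  ∈-insert⁺ a (b ∷ π) with Lex? a b
  ... | yes _ = hereᵛ refl
  ... | no _ = thereᵛ (∈-insert⁺ a π)

  ∈-insert⁺-old : ∀ {m x} a (π : Vec (Fin k) m) → x ∈ᵛ π → x ∈ᵛ insert a π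
  ∈-insert⁺-old a (b ∷ π) x∈ with Lex? a b
  ... | yes _ = thereᵛ x∈
  ∈-insert⁺-old a (b ∷ π) (hereᵛ refl) | no _ = hereᵛ refl
  ∈-insert⁺-old a (b ∷ π) (thereᵛ x∈) | no _ = thereᵛ (∈-insert⁺-old a π x∈)

  ∈-insert⁻ : ∀ {m x} a (π : Vec (Fin k) m) → x ∈ᵛ insert a π → x ≡ a ⊎ x ∈ᵛ π
  ∈-insert⁻ a [] (hereᵛ eq) = inj₁ eq
  ∈-insert⁻ a (b ∷ π) x∈ with Lex? a b
  ∈-insert⁻ a (b ∷ π) (hereᵛ eq) | yes _ = inj₁ eq
  ∈-insert⁻ a (b ∷ π) (thereᵛ x∈) | yes _ = inj₂ x∈
  ∈-insert⁻ a (b ∷ π) (hereᵛ eq) | no _ = inj₂ (hereᵛ eq)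
  ∈-insert⁻ a (b ∷ π) (thereᵛ x∈) | no _ with ∈-insert⁻ a π x∈
  ... | inj₁ eq = inj₁ eq
  ... | inj₂ p = inj₂ (thereᵛ p)

  insert-sorted : ∀ {m} a (π : Vec (Fin k) m) → (∀ {b} → b ∈ᵛ π → a ≢ b) → Sorted π → Sorted (insert a π)
  insert-sorted a [] _ _ = (λ ()) , tt
  insert-sorted a (b ∷ π) a∉ (b< , ok) with Lex? a b
  ... | yes a<b = (λ { (hereᵛ refl) → a<b ; (thereᵛ p) → Lex-trans a<b (b< p) }) , b< , ok
  ... | no ¬a<b = below , insert-sorted a π (a∉ ∘ thereᵛ) ok
    where
    below : ∀ {c} → c ∈ᵛ insert a π → Lex b c
    below c∈ with ∈-insert⁻ a π c∈
    ... | inj₂ p = b< p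
    ... | inj₁ refl with Lex-connex a b (a∉ (hereᵛ refl))
    ...   | inj₁ a<b = contradiction a<b ¬a<b
    ...   | inj₂ b<a = b<a

  -- Insertion sort of a family; only the case `id` is needed, but the recursion restricts the
  -- family to shorter index sets.
  sort : ∀ {m} → (Fin m → Fin k) → Vec (Fin k) m
  sort {zero} i = []
  sort {suc m} i = insert (i Fin.zero) (sort (i ∘ Fin.suc))

  ∈-sort⁺ : ∀ {m} (i : Fin m → Fin k) s → i s ∈ᵛ sort i
  ∈-sort⁺ i Fin.zero = ∈-insert⁺ (i Fin.zero) (sort (i ∘ Fin.suc))
  ∈-sort⁺ i (Fin.suc s) = ∈-insert⁺-old (i Fin.zero) (sort (i ∘ Fin.suc)) (∈-sort⁺ (i ∘ Fin.suc) s)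

  ∈-sort⁻ : ∀ {m x} (i : Fin m → Fin k) → x ∈ᵛ sort i → ∃[ s ] i s ≡ x
  ∈-sort⁻ {suc m} i x∈ with ∈-insert⁻ (i Fin.zero) (sort (i ∘ Fin.suc)) x∈
  ... | inj₁ eq = Fin.zero , sym eq
  ... | inj₂ p with ∈-sort⁻ (i ∘ Fin.suc) p
  ...   | s , eq = Fin.suc s , eq

  sort-sorted : ∀ {m} (i : Fin m → Fin k) → (∀ {s t} → i s ≡ i t → s ≡ t) → Sorted (sort i)
  sort-sorted {zero} i inj = tt
  sort-sorted {suc m} i inj = insert-sorted (i Fin.zero) (sort (i ∘ Fin.suc)) fresh
    (sort-sorted (i ∘ Fin.suc) (Fin.suc-injective ∘ inj))
    where
    fresh : ∀ {b} → b ∈ᵛ sort (i ∘ Fin.suc) → i Fin.zero ≢ b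
    fresh b∈ eq with ∈-sort⁻ (i ∘ Fin.suc) b∈
    ... | s , refl with inj eq
    ...   | ()

-- The words w₀ w₁ … with w₀ = v and last letter ℓ − 1 whose steps are 0 or 1,
-- a step 0 being forbidden at the descents of π.
words : ∀ {k m} → ℕ → ℕ → Vec (Fin k) m → List (Vec ℕ m)
words ℓ v [] = []
words ℓ v (a ∷ []) = if ⌊ suc v ≟ ℓ ⌋ then (v ∷ []) ∷ [] else []
words ℓ v (a ∷ b ∷ π) =
  (if ⌊ toℕ b <? toℕ a ⌋ then [] else map (v ∷_) (words ℓ v (b ∷ π))) ++ map (v ∷_) (words ℓ (suc v) (b ∷ π))

-- The coefficient of x^ℓ in x^(d+1) (1+x)^m.
T : ℕ → ℕ → ℕ → ℕ
T d zero ℓ = if ⌊ suc d ≟ ℓ ⌋ then 1 else 0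
T d (suc m) ℓ = T d m ℓ + T (suc d) m ℓ

des-≤ : ∀ {k m} (a : Fin k) (π : Vec (Fin k) m) → des (a ∷ π) ≤ m
des-≤ a [] = z≤n
des-≤ a (b ∷ π) with toℕ b <? toℕ a
... | yes _ = s≤s (des-≤ b π)
... | no _ = ℕ.≤-trans (des-≤ b π) (ℕ.n≤1+n _)

-- A descent forces a step 1 and raises the exponent of x; any other position leaves a free choice
-- and contributes a factor 1 + x. The last letter is ℓ - 1, which accounts for one further factor
-- x.
length-words : ∀ {k m} ℓ v (a : Fin k) (π : Vec (Fin k) m) →
  length (words ℓ v (a ∷ π)) ≡ T (v + des (a ∷ π)) (m ∸ des (a ∷ π)) ℓ
length-words ℓ v a [] rewrite ℕ.+-identityʳ v with suc v ≟ ℓ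
... | yes _ = refl
... | no _ = refl
length-words {m = suc m} ℓ v a (b ∷ π) with toℕ b <? toℕ a
... | yes _ = begin
  length (map (v ∷_) (words ℓ (suc v) (b ∷ π))) ≡⟨ List.length-map (v ∷_) (words ℓ (suc v) (b ∷ π)) ⟩
  length (words ℓ (suc v) (b ∷ π))              ≡⟨ length-words ℓ (suc v) b π ⟩
  T (suc v + des (b ∷ π)) (m ∸ des (b ∷ π)) ℓ   ≡⟨ cong (λ d → T d (m ∸ des (b ∷ π)) ℓ) (sym (ℕ.+-suc v _)) ⟩
  T (v + suc (des (b ∷ π))) (m ∸ des (b ∷ π)) ℓ ∎
  where open ≡-Reasoning
... | no _ = begin
  length (map (v ∷_) (words ℓ v (b ∷ π)) ++ map (v ∷_) (words ℓ (suc v) (b ∷ π)))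
    ≡⟨ trans (List.length-++ (map (v ∷_) (words ℓ v (b ∷ π))))
         (cong₂ _+_ (List.length-map (v ∷_) (words ℓ v (b ∷ π))) (List.length-map (v ∷_) (words ℓ (suc v) (b ∷ π)))) ⟩
  length (words ℓ v (b ∷ π)) + length (words ℓ (suc v) (b ∷ π))
    ≡⟨ cong₂ _+_ (length-words ℓ v b π) (length-words ℓ (suc v) b π) ⟩
  T (v + des (b ∷ π)) (suc (m ∸ des (b ∷ π))) ℓ
    -- Subtraction is truncated, so `suc` moves across it only because des ≤ m.
    ≡⟨ cong (λ j → T (v + des (b ∷ π)) j ℓ) (sym (ℕ.+-∸-assoc 1 (des-≤ b π))) ⟩
  T (v + des (b ∷ π)) (suc m ∸ des (b ∷ π)) ℓ ∎
  where open ≡-Reasoning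

∈-words-head : ∀ {k m} ℓ v (a : Fin k) (π : Vec (Fin k) m) {w} → w ∈ words ℓ v (a ∷ π) → Vec.head w ≡ v
∈-words-head ℓ v a [] w∈ with suc v ≟ ℓ
∈-words-head ℓ v a [] (here refl) | yes _ = refl
∈-words-head ℓ v a (b ∷ π) w∈ with toℕ b <? toℕ a
∈-words-head ℓ v a (b ∷ π) w∈ | yes _ with ∈-map⁻ (v ∷_) w∈
... | _ , _ , refl = refl
∈-words-head ℓ v a (b ∷ π) w∈ | no _ with ∈-++⁻ (map (v ∷_) (words ℓ v (b ∷ π))) w∈
... | inj₁ p with ∈-map⁻ (v ∷_) p
...   | _ , _ , refl = refl
∈-words-head ℓ v a (b ∷ π) w∈ | no _ | inj₂ p with ∈-map⁻ (v ∷_) p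
...   | _ , _ , refl = refl

words-unique : ∀ {k m} ℓ v (a : Fin k) (π : Vec (Fin k) m) → Unique (words ℓ v (a ∷ π))
words-unique ℓ v a [] with suc v ≟ ℓ
... | yes _ = [] ∷ []
... | no _ = []
words-unique ℓ v a (b ∷ π) with toℕ b <? toℕ a
... | yes _ = Unique.map⁺ Vec.∷-injectiveʳ (words-unique ℓ (suc v) b π)
... | no _ = Unique.++⁺ (Unique.map⁺ Vec.∷-injectiveʳ (words-unique ℓ v b π))
                        (Unique.map⁺ Vec.∷-injectiveʳ (words-unique ℓ (suc v) b π)) disjoint
  where
  disjoint : ∀ {w} → w ∈ map (v ∷_) (words ℓ v (b ∷ π)) × w ∈ map (v ∷_) (words ℓ (suc v) (b ∷ π)) → ⊥
  disjoint (p , q) with ∈-map⁻ (v ∷_) p | ∈-map⁻ (v ∷_) q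
  ... | w , w∈ , refl | _ , w'∈ , refl =
    ℕ.1+n≢n (trans (sym (∈-words-head ℓ (suc v) b π w'∈)) (∈-words-head ℓ v b π w∈))

module _ {k : ℕ} (g : Fin k → ℕ) (ℓ : ℕ) where

  -- The values of g on the entries are exactly v, ..., ℓ - 1. This form of surjectivity survives
  -- the removal of the head of a sorted vector, with v or v + 1 as the new start.
  Onto : ∀ {m} → ℕ → Vec (Fin k) m → Set
  Onto v π = (∀ {b} → b ∈ᵛ π → v ≤ g b × g b < ℓ) × (∀ {t} → v ≤ t → t < ℓ → ∃[ b ] b ∈ᵛ π × g b ≡ t)

  -- Sorting makes the values weakly increasing and `Onto` forbids gaps, so steps are 0 or 1; at a
  -- step 0 the index must increase, which rules out a descent.
  ∈-words⁺ : ∀ {m} v (a : Fin k) (π : Vec (Fin k) m) → g a ≡ v → Sorted g (a ∷ π) → Onto v (a ∷ π) →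
    Vec.map g (a ∷ π) ∈ words ℓ v (a ∷ π)
  ∈-words⁺ v a [] refl _ (bound , onto) with suc v ≟ ℓ
  ... | yes _ = here refl
  ... | no sv≢ℓ with onto (ℕ.n≤1+n v) (ℕ.≤∧≢⇒< (proj₂ (bound (hereᵛ refl))) sv≢ℓ)
  ...   | b , hereᵛ refl , eq = contradiction (sym eq) ℕ.1+n≢n
  ∈-words⁺ v a (b ∷ π) refl (a< , sorted@(b< , _)) (bound , onto) with toℕ b <? toℕ a | ℕ.m≤n⇒m<n∨m≡n (proj₁ (bound (thereᵛ (hereᵛ refl))))
  -- A step 1 is allowed at a descent and elsewhere alike, so the outcome of the test stays open.
  ... | dec | inj₁ v<gb = ∈-++⁺ʳ (if ⌊ dec ⌋ then [] else _) (∈-map⁺ (v ∷_) (∈-words⁺ (suc v) b π gb≡ sorted (bound' , onto')))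
    where
    -- The value g a + 1 is attained on b ∷ π, whose smallest value is g b.
    least : ∃[ c ] c ∈ᵛ a ∷ b ∷ π × g c ≡ suc v → g b ≤ suc v
    least (_ , hereᵛ refl , eq) = contradiction (sym eq) ℕ.1+n≢n
    least (_ , thereᵛ (hereᵛ refl) , eq) = ℕ.≤-reflexive eq
    least (_ , thereᵛ (thereᵛ p) , eq) = subst (g b ≤_) eq (Lex⇒≤ g (b< p))

    gb≡ : g b ≡ suc v
    gb≡ = ℕ.≤-antisym (least (onto (ℕ.n≤1+n v) (ℕ.≤-<-trans v<gb (proj₂ (bound (thereᵛ (hereᵛ refl))))))) v<gb

    bound' : ∀ {c} → c ∈ᵛ b ∷ π → suc v ≤ g c × g c < ℓ
    bound' (hereᵛ refl) = v<gb , proj₂ (bound (thereᵛ (hereᵛ refl)))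
    bound' (thereᵛ p) = ℕ.≤-trans v<gb (Lex⇒≤ g (b< p)) , proj₂ (bound (thereᵛ (thereᵛ p)))

    onto' : ∀ {t} → suc v ≤ t → t < ℓ → ∃[ c ] c ∈ᵛ b ∷ π × g c ≡ t
    onto' v<t t<ℓ with onto (ℕ.<⇒≤ v<t) t<ℓ
    ... | _ , hereᵛ refl , eq = contradiction eq (ℕ.<⇒≢ v<t)
    ... | c , thereᵛ p , eq = c , p , eq
  ... | yes b<a | inj₂ v≡gb with a< (hereᵛ refl)
  ...   | inj₁ v<gb = contradiction v≡gb (ℕ.<⇒≢ v<gb)
  ...   | inj₂ (_ , a<b) = contradiction a<b (ℕ.<-asym b<a)
  ∈-words⁺ v a (b ∷ π) refl (a< , sorted) (bound , onto) | no _ | inj₂ v≡gb =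
    ∈-++⁺ˡ (∈-map⁺ (v ∷_) (∈-words⁺ v b π (sym v≡gb) sorted ((λ p → bound (thereᵛ p)) , onto')))
    where
    onto' : ∀ {t} → v ≤ t → t < ℓ → ∃[ c ] c ∈ᵛ b ∷ π × g c ≡ t
    onto' v≤t t<ℓ with onto v≤t t<ℓ
    ... | _ , hereᵛ refl , eq = b , hereᵛ refl , trans (sym v≡gb) eq
    ... | c , thereᵛ p , eq = c , p , eq

  -- At a step 0 the word only guarantees that π does not descend. Injectivity of π makes this a
  -- strict ascent, as `Lex` requires; a step 1 gives `Lex` through g.
  ∈-words⁻ : ∀ {m} v (a : Fin k) (π : Vec (Fin k) m) →
    (∀ {s t} → Vec.lookup (a ∷ π) s ≡ Vec.lookup (a ∷ π) t → s ≡ t) →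
    Vec.map g (a ∷ π) ∈ words ℓ v (a ∷ π) → g a ≡ v × Sorted g (a ∷ π) × Onto v (a ∷ π)
  ∈-words⁻ v a [] inj w∈ with suc v ≟ ℓ
  ∈-words⁻ v a [] inj (here refl) | yes refl = refl , ((λ ()) , tt) ,
    (λ { (hereᵛ refl) → ℕ.≤-refl , ℕ.≤-refl }) , (λ v≤t t<ℓ → a , hereᵛ refl , ℕ.≤-antisym v≤t (ℕ.≤-pred t<ℓ))
  ∈-words⁻ {suc m} v a (b ∷ π) inj w∈ = extend (split w∈)
    where
    injᵗ : ∀ {s t} → Vec.lookup (b ∷ π) s ≡ Vec.lookup (b ∷ π) t → s ≡ t
    injᵗ = Fin.suc-injective ∘ inj

    split : Vec.map g (a ∷ b ∷ π) ∈ words ℓ v (a ∷ b ∷ π) →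
      g a ≡ v × ((Vec.map g (b ∷ π) ∈ words ℓ v (b ∷ π) × ¬ b Fin.< a) ⊎ Vec.map g (b ∷ π) ∈ words ℓ (suc v) (b ∷ π))
    split w∈ with toℕ b <? toℕ a
    split w∈ | yes _ with ∈-map⁻ (v ∷_) w∈
    ... | _ , p , eq with Vec.∷-injective eq
    ...   | refl , refl = refl , inj₂ p
    split w∈ | no b≮a with ∈-++⁻ (map (v ∷_) (words ℓ v (b ∷ π))) w∈
    ... | inj₁ q with ∈-map⁻ (v ∷_) q
    ...   | _ , p , eq with Vec.∷-injective eq
    ...     | refl , refl = refl , inj₁ (p , b≮a)
    split w∈ | no b≮a | inj₂ q with ∈-map⁻ (v ∷_) q
    ...   | _ , p , eq with Vec.∷-injective eq
    ...     | refl , refl = refl , inj₂ p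

    prepend : ∀ {v'} → Lex g a b → v ≤ v' → (v' ≡ v ⊎ v' ≡ suc v) → g a ≡ v → g b ≡ v' × Sorted g (b ∷ π) × Onto v' (b ∷ π) →
      g a ≡ v × Sorted g (a ∷ b ∷ π) × Onto v (a ∷ b ∷ π)
    prepend {v'} a<b v≤v' step ga≡v (gb≡v' , (b< , sorted) , bound , onto) = ga≡v ,
      ((λ { (hereᵛ refl) → a<b ; (thereᵛ p) → Lex-trans g a<b (b< p) }) , b< , sorted) ,
      (λ { (hereᵛ refl) → ℕ.≤-reflexive (sym ga≡v) , subst (_< ℓ) (sym ga≡v) (ℕ.≤-<-trans v≤v' (subst (_< ℓ) gb≡v' (proj₂ (bound (hereᵛ refl)))))
         ; (thereᵛ p) → ℕ.≤-trans v≤v' (proj₁ (bound p)) , proj₂ (bound p) }) ,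
      onto' step
      where
      onto' : (v' ≡ v ⊎ v' ≡ suc v) → ∀ {t} → v ≤ t → t < ℓ → ∃[ c ] c ∈ᵛ a ∷ b ∷ π × g c ≡ t
      onto' (inj₁ refl) v≤t t<ℓ with onto v≤t t<ℓ
      ... | c , p , eq = c , thereᵛ p , eq
      onto' (inj₂ refl) v≤t t<ℓ with ℕ.m≤n⇒m<n∨m≡n v≤t
      ... | inj₂ refl = a , hereᵛ refl , ga≡v
      ... | inj₁ v<t with onto v<t t<ℓ
      ...   | c , p , eq = c , thereᵛ p , eq

    extend : g a ≡ v × ((Vec.map g (b ∷ π) ∈ words ℓ v (b ∷ π) × ¬ b Fin.< a) ⊎ Vec.map g (b ∷ π) ∈ words ℓ (suc v) (b ∷ π)) →
      g a ≡ v × Sorted g (a ∷ b ∷ π) × Onto v (a ∷ b ∷ π)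
    extend (ga≡v , inj₁ (p , b≮a)) = prepend
      (inj₂ (trans ga≡v (sym (proj₁ (∈-words⁻ v b π injᵗ p))) ,
        ℕ.≤∧≢⇒< (ℕ.≮⇒≥ b≮a) (λ eq → contradiction (inj {Fin.zero} {Fin.suc Fin.zero} (Fin.toℕ-injective eq)) (λ ()))))
      ℕ.≤-refl (inj₁ refl) ga≡v (∈-words⁻ v b π injᵗ p)
    extend (ga≡v , inj₂ p) = prepend
      (inj₁ (subst₂ _<_ (sym ga≡v) (sym (proj₁ (∈-words⁻ (suc v) b π injᵗ p))) ℕ.≤-refl))
      (ℕ.n≤1+n v) (inj₂ refl) ga≡v (∈-words⁻ (suc v) b π injᵗ p)

  sorted⇒word : ∀ {m} (π : Vec (Fin k) (suc m)) → Sorted g π → (∀ b → g b < ℓ) →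
    (∀ {t} → t < ℓ → ∃[ b ] b ∈ᵛ π × g b ≡ t) → Vec.map g π ∈ words ℓ 0 π
  sorted⇒word (a ∷ π) sorted bound onto =
    -- The value 0 is attained because 0 ≤ g a < ℓ, and the head carries the least value.
    ∈-words⁺ 0 a π (ℕ.n≤0⇒n≡0 (least (onto (ℕ.≤-<-trans z≤n (bound a))))) sorted
      ((λ {b} _ → z≤n , bound b) , (λ _ t<ℓ → onto t<ℓ))
    where
    least : ∃[ b ] b ∈ᵛ a ∷ π × g b ≡ 0 → g a ≤ 0
    least (_ , hereᵛ refl , eq) = ℕ.≤-reflexive eq
    least (_ , thereᵛ p , eq) = subst (g a ≤_) eq (Lex⇒≤ g (proj₁ sorted p))

  word⇒sorted : ∀ {m} (π : Vec (Fin k) (suc m)) → (∀ {s t} → Vec.lookup π s ≡ Vec.lookup π t → s ≡ t) →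
    Vec.map g π ∈ words ℓ 0 π → Sorted g π × Onto 0 π
  word⇒sorted (a ∷ π) injective w∈ = proj₂ (∈-words⁻ 0 a π injective w∈)

-- Coefficients and the rational functional

coeff-+P : ∀ p q ℓ → coeff (p +P q) ℓ ≡ coeff p ℓ + coeff q ℓ
coeff-+P [] q ℓ = refl
coeff-+P (c ∷ cs) [] ℓ = sym (ℕ.+-identityʳ _)
coeff-+P (c ∷ cs) (d ∷ ds) zero = refl
coeff-+P (c ∷ cs) (d ∷ ds) (suc ℓ) = coeff-+P cs ds ℓ

coeff-scaleP : ∀ c q ℓ → coeff (scaleP c q) ℓ ≡ c * coeff q ℓ
coeff-scaleP c [] ℓ = sym (ℕ.*-zeroʳ c)
coeff-scaleP c (d ∷ ds) zero = refl
coeff-scaleP c (d ∷ ds) (suc ℓ) = coeff-scaleP c ds ℓ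

coeff-∷*P : ∀ c cs q ℓ → coeff ((c ∷ cs) *P q) ℓ ≡ c * coeff q ℓ + coeff (0 ∷ (cs *P q)) ℓ
coeff-∷*P c cs q ℓ = trans (coeff-+P (scaleP c q) _ ℓ) (cong (_+ _) (coeff-scaleP c q ℓ))

-- Coefficient lists are not normalised: x times p and `0 ∷ p` may differ by trailing zeros, so
-- factors are exchanged up to equality of coefficients.
*P-congˡ : ∀ p p' q → (∀ ℓ → coeff p ℓ ≡ coeff p' ℓ) → ∀ ℓ → coeff (p *P q) ℓ ≡ coeff (p' *P q) ℓ
*P-congˡ [] [] q eq ℓ = refl
*P-congˡ (c ∷ cs) (c' ∷ cs') q eq ℓ =
  trans (coeff-∷*P c cs q ℓ) (trans (cong₂ _+_ (cong (_* coeff q ℓ) (eq 0)) (tails ℓ)) (sym (coeff-∷*P c' cs' q ℓ)))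
  where
  tails : ∀ ℓ → coeff (0 ∷ (cs *P q)) ℓ ≡ coeff (0 ∷ (cs' *P q)) ℓ
  tails zero = refl
  tails (suc ℓ) = *P-congˡ cs cs' q (eq ∘ suc) ℓ
*P-congˡ [] (c' ∷ cs') q eq ℓ =
  sym (trans (coeff-∷*P c' cs' q ℓ) (cong₂ _+_ (cong (_* coeff q ℓ) (sym (eq 0))) (tails ℓ)))
  where
  tails : ∀ ℓ → coeff (0 ∷ (cs' *P q)) ℓ ≡ 0
  tails zero = refl
  tails (suc ℓ) = sym (*P-congˡ [] cs' q (eq ∘ suc) ℓ)
*P-congˡ (c ∷ cs) [] q eq ℓ =
  trans (coeff-∷*P c cs q ℓ) (cong₂ _+_ (cong (_* coeff q ℓ) (eq 0)) (tails ℓ))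
  where
  tails : ∀ ℓ → coeff (0 ∷ (cs *P q)) ℓ ≡ 0
  tails zero = refl
  tails (suc ℓ) = *P-congˡ cs [] q (eq ∘ suc) ℓ

-- Multiplication by x^d on coefficient functions.
shiftCoeff : ℕ → (ℕ → ℕ) → ℕ → ℕ
shiftCoeff zero h ℓ = h ℓ
shiftCoeff (suc d) h zero = 0
shiftCoeff (suc d) h (suc ℓ) = shiftCoeff d h ℓ

shiftCoeff-cong : ∀ d {h h'} → (∀ ℓ → h ℓ ≡ h' ℓ) → ∀ ℓ → shiftCoeff d h ℓ ≡ shiftCoeff d h' ℓ
shiftCoeff-cong zero eq ℓ = eq ℓ
shiftCoeff-cong (suc d) eq zero = refl
shiftCoeff-cong (suc d) eq (suc ℓ) = shiftCoeff-cong d eq ℓ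

shiftCoeff-+ : ∀ d h ℓ → shiftCoeff d (λ ℓ → h ℓ + shiftCoeff 1 h ℓ) ℓ ≡ shiftCoeff d h ℓ + shiftCoeff (suc d) h ℓ
shiftCoeff-+ zero h ℓ = refl
shiftCoeff-+ (suc d) h zero = refl
shiftCoeff-+ (suc d) h (suc ℓ) = shiftCoeff-+ d h ℓ

coeff-1*P : ∀ q ℓ → coeff ((1 ∷ []) *P q) ℓ ≡ coeff q ℓ
coeff-1*P q ℓ = trans (coeff-∷*P 1 [] q ℓ) (trans (cong₂ _+_ (ℕ.*-identityˡ (coeff q ℓ)) (zeros ℓ)) (ℕ.+-identityʳ _))
  where
  zeros : ∀ ℓ → coeff (0 ∷ []) ℓ ≡ 0
  zeros zero = refl
  zeros (suc ℓ) = refl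

coeff-shift : ∀ q h → (∀ ℓ → coeff q ℓ ≡ h ℓ) → ∀ ℓ → coeff (0 ∷ q) ℓ ≡ shiftCoeff 1 h ℓ
coeff-shift q h eq zero = refl
coeff-shift q h eq (suc ℓ) = eq ℓ

coeff-x*P : ∀ q ℓ → coeff (xP *P q) ℓ ≡ coeff (0 ∷ q) ℓ
coeff-x*P q zero = coeff-∷*P 0 (1 ∷ []) q zero
coeff-x*P q (suc ℓ) = trans (coeff-∷*P 0 (1 ∷ []) q (suc ℓ)) (coeff-1*P q ℓ)

coeff-[1+x]*P : ∀ q ℓ → coeff (onePlusX *P q) ℓ ≡ coeff q ℓ + shiftCoeff 1 (coeff q) ℓ
coeff-[1+x]*P q ℓ = trans (coeff-∷*P 1 (1 ∷ []) q ℓ)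
  (cong₂ _+_ (ℕ.*-identityˡ (coeff q ℓ)) (coeff-shift ((1 ∷ []) *P q) (coeff q) (coeff-1*P q) ℓ))

coeff-x^d*P : ∀ d r ℓ → coeff ((xP ^P d) *P r) ℓ ≡ shiftCoeff d (coeff r) ℓ
coeff-x^d*P zero r ℓ = coeff-1*P r ℓ
coeff-x^d*P (suc d) r ℓ = trans (*P-congˡ (xP *P (xP ^P d)) (0 ∷ (xP ^P d)) r (coeff-x*P (xP ^P d)) ℓ)
  (trans (coeff-∷*P 0 (xP ^P d) r ℓ) (shifted ℓ))
  where
  shifted : ∀ ℓ → coeff (0 ∷ ((xP ^P d) *P r)) ℓ ≡ shiftCoeff (suc d) (coeff r) ℓ
  shifted zero = refl
  shifted (suc ℓ) = coeff-x^d*P d r ℓ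

shiftCoeff-1 : ∀ d ℓ → shiftCoeff d (coeff (1 ∷ [])) ℓ ≡ (if ⌊ d ≟ ℓ ⌋ then 1 else 0)
shiftCoeff-1 zero zero = refl
shiftCoeff-1 zero (suc ℓ) = refl
shiftCoeff-1 (suc d) zero = refl
shiftCoeff-1 (suc d) (suc ℓ) = trans (shiftCoeff-1 d ℓ) same
  where
  same : (if ⌊ d ≟ ℓ ⌋ then 1 else 0) ≡ (if ⌊ suc d ≟ suc ℓ ⌋ then 1 else 0)
  same with d ≟ ℓ | suc d ≟ suc ℓ
  ... | yes _  | yes _ = refl
  ... | no _   | no _ = refl
  ... | yes eq | no ≢ = contradiction (cong suc eq) ≢
  ... | no ≢   | yes eq = contradiction (ℕ.suc-injective eq) ≢

T≡shiftCoeff : ∀ d m ℓ → T d m ℓ ≡ shiftCoeff (suc d) (coeff (onePlusX ^P m)) ℓ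
T≡shiftCoeff d zero ℓ = sym (shiftCoeff-1 (suc d) ℓ)
T≡shiftCoeff d (suc m) ℓ = trans (cong₂ _+_ (T≡shiftCoeff d m ℓ) (T≡shiftCoeff (suc d) m ℓ))
  (trans (sym (shiftCoeff-+ (suc d) (coeff (onePlusX ^P m)) ℓ))
    (sym (shiftCoeff-cong (suc d) (coeff-[1+x]*P (onePlusX ^P m)) ℓ)))

T≡coeff : ∀ d m ℓ → T d m ℓ ≡ coeff ((xP ^P (1 + d)) *P (onePlusX ^P m)) ℓ
T≡coeff d m ℓ = trans (T≡shiftCoeff d m ℓ) (sym (coeff-x^d*P (suc d) (onePlusX ^P m) ℓ))

T-0 : ∀ d m → T d m 0 ≡ 0
T-0 d m = T≡shiftCoeff d m 0

-- Reciprocals of the numbers p C(p-1,d)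

ι : ℕ → ℚ
ι n = ℤ.+ n ℚ./ 1

toℚᵘ-ι : ∀ n → toℚᵘ (ι n) ℚᵘ.≃ mkℚᵘ (ℤ.+ n) 0
toℚᵘ-ι n = ℚ.toℚᵘ-fromℚᵘ (mkℚᵘ (ℤ.+ n) 0)

ι-+ : ∀ m n → ι (m + n) ≡ ι m ℚ.+ ι n
ι-+ m n = ℚ.toℚᵘ-injective (begin
  toℚᵘ (ι (m + n)) ≈⟨ toℚᵘ-ι (m + n) ⟩
  mkℚᵘ (ℤ.+ (m + n)) 0 ≈⟨ *≡* (cong (ℤ._* ℤ.+ 1) (trans (ℤ.pos-+ m n) (sym (cong₂ ℤ._+_ (ℤ.*-identityʳ (ℤ.+ m)) (ℤ.*-identityʳ (ℤ.+ n)))))) ⟩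
  mkℚᵘ (ℤ.+ m) 0 ℚᵘ.+ mkℚᵘ (ℤ.+ n) 0 ≈⟨ ℚᵘ.+-cong (toℚᵘ-ι m) (toℚᵘ-ι n) ⟨
  toℚᵘ (ι m) ℚᵘ.+ toℚᵘ (ι n) ≈⟨ ℚ.toℚᵘ-homo-+ (ι m) (ι n) ⟨
  toℚᵘ (ι m ℚ.+ ι n) ∎)
  where open ℚᵘ.≃-Reasoning

ι-* : ∀ m n → ι (m * n) ≡ ι m ℚ.* ι n
ι-* m n = ℚ.toℚᵘ-injective (begin
  toℚᵘ (ι (m * n)) ≈⟨ toℚᵘ-ι (m * n) ⟩
  mkℚᵘ (ℤ.+ (m * n)) 0 ≈⟨ *≡* (cong (ℤ._* ℤ.+ 1) (ℤ.pos-* m n)) ⟩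
  mkℚᵘ (ℤ.+ m) 0 ℚᵘ.* mkℚᵘ (ℤ.+ n) 0 ≈⟨ ℚᵘ.*-cong (toℚᵘ-ι m) (toℚᵘ-ι n) ⟨
  toℚᵘ (ι m) ℚᵘ.* toℚᵘ (ι n) ≈⟨ ℚ.toℚᵘ-homo-* (ι m) (ι n) ⟨
  toℚᵘ (ι m ℚ.* ι n) ∎)
  where open ℚᵘ.≃-Reasoning

recip-inverse : ∀ n → n ≢ 0 → recip n ℚ.* ι n ≡ 1ℚ
recip-inverse zero n≢0 = contradiction refl n≢0
recip-inverse (suc n) _ = ℚ.toℚᵘ-injective (begin
  toℚᵘ (recip (suc n) ℚ.* ι (suc n)) ≈⟨ ℚ.toℚᵘ-homo-* (recip (suc n)) (ι (suc n)) ⟩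
  toℚᵘ (recip (suc n)) ℚᵘ.* toℚᵘ (ι (suc n)) ≈⟨ ℚᵘ.*-cong (ℚ.toℚᵘ-fromℚᵘ (mkℚᵘ (ℤ.+ 1) n)) (toℚᵘ-ι (suc n)) ⟩
  mkℚᵘ (ℤ.+ 1) n ℚᵘ.* mkℚᵘ (ℤ.+ suc n) 0 ≈⟨ *≡* (cong ℤ.+_ (lemma n)) ⟩
  toℚᵘ 1ℚ ∎)
  where
  open ℚᵘ.≃-Reasoning
  lemma : ∀ n → (1 * suc n) * 1 ≡ 1 * (suc n * 1)
  lemma = solve-∀

-- Brings reciprocals to the common denominator z: insert `recip z` times `ι z`, which is 1, and
-- cancel x, nonzero because z is.
recip-scale : ∀ {x y z} → x * y ≡ z → z ≢ 0 → recip x ≡ recip z ℚ.* ι y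
recip-scale {x} {y} refl z≢0 = begin
  recip x ≡⟨ ℚ.*-identityʳ (recip x) ⟨
  recip x ℚ.* 1ℚ ≡⟨ cong (recip x ℚ.*_) (recip-inverse (x * y) z≢0) ⟨
  recip x ℚ.* (recip (x * y) ℚ.* ι (x * y)) ≡⟨ cong (λ i → recip x ℚ.* (recip (x * y) ℚ.* i)) (ι-* x y) ⟩
  recip x ℚ.* (recip (x * y) ℚ.* (ι x ℚ.* ι y)) ≡⟨ rearrange (recip x) (recip (x * y)) (ι x) (ι y) ⟩
  recip x ℚ.* ι x ℚ.* (recip (x * y) ℚ.* ι y) ≡⟨ cong (ℚ._* (recip (x * y) ℚ.* ι y)) (recip-inverse x (λ { refl → z≢0 refl })) ⟩
  1ℚ ℚ.* (recip (x * y) ℚ.* ι y) ≡⟨ ℚ.*-identityˡ _ ⟩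
  recip (x * y) ℚ.* ι y ∎
  where
  open ≡-Reasoning
  rearrange : ∀ a b c d → a ℚ.* (b ℚ.* (c ℚ.* d)) ≡ a ℚ.* c ℚ.* (b ℚ.* d)
  rearrange = let open +-*-Solver in
    solve 4 (λ a b c d → a :* (b :* (c :* d)) := a :* c :* (b :* d)) refl

C-factorial : ∀ d m → ((d + m) C d) * (d ! * m !) ≡ (d + m) !
C-factorial d m = begin
  ((d + m) C d) * (d ! * m !) ≡⟨ cong (λ j → ((d + m) C d) * (d ! * j !)) (ℕ.m+n∸m≡n d m) ⟨
  ((d + m) C d) * (d ! * (d + m ∸ d) !) ≡⟨ cong (_* (d ! * (d + m ∸ d) !)) (nCk≡n!/k![n-k]! d≤) ⟩
  _ ≡⟨ m/n*n≡m {{ℕ.m*n≢0 (d !) ((d + m ∸ d) !) {{d ℕ.!≢0}} {{(d + m ∸ d) ℕ.!≢0}}}} (k![n∸k]!∣n! d≤) ⟩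
  (d + m) ! ∎
  where
  open ≡-Reasoning
  d≤ : d ≤ d + m
  d≤ = ℕ.m≤m+n d m

-- The denominator p · C(p−1, d) for p − 1 = d + m.
denom : ℕ → ℕ → ℕ
denom d m = suc (d + m) * ((d + m) C d)

denom-factorial : ∀ d m → denom d m * (d ! * m !) ≡ suc (d + m) !
denom-factorial d m = trans (ℕ.*-assoc (suc (d + m)) ((d + m) C d) (d ! * m !)) (cong (suc (d + m) *_) (C-factorial d m))

n!≢0 : ∀ n → n ! ≢ 0
n!≢0 n = ≢-nonZero⁻¹ (n !) {{n ℕ.!≢0}}

denom≢0 : ∀ d m → denom d m ≢ 0
denom≢0 d m eq = n!≢0 (suc (d + m)) (trans (sym (denom-factorial d m)) (cong (_* (d ! * m !)) eq))

-- After multiplication by d! m! both sides are (d+m+2)!, and this factor can be cancelled.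
denom-step : ∀ d m x z → x * z * (d ! * m !) ≡ suc (suc (d + m)) ! → x * z ≡ suc (suc (d + m)) * denom d m
denom-step d m x z eq = ℕ.*-cancelʳ-≡ _ _ (d ! * m !) {{ℕ.m*n≢0 (d !) (m !) {{d ℕ.!≢0}} {{m ℕ.!≢0}}}}
  (trans eq (sym (trans (ℕ.*-assoc (suc (suc (d + m))) (denom d m) _) (cong (suc (suc (d + m)) *_) (denom-factorial d m)))))

denom-sucˡ : ∀ d m → denom (suc d) m * suc d ≡ suc (suc (d + m)) * denom d m
denom-sucˡ d m = denom-step d m (denom (suc d) m) (suc d)
  (trans (lemma (denom (suc d) m) (suc d) (d !) (m !)) (denom-factorial (suc d) m))
  where
  lemma : ∀ a b c e → a * b * (c * e) ≡ a * (b * c * e)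
  lemma = solve-∀

denom-sucʳ : ∀ d m → denom d (suc m) * suc m ≡ suc (suc (d + m)) * denom d m
denom-sucʳ d m = denom-step d m (denom d (suc m)) (suc m)
  (trans (lemma (denom d (suc m)) (suc m) (d !) (m !)) (trans (denom-factorial d (suc m)) (cong (λ j → suc j !) (ℕ.+-suc d m))))
  where
  lemma : ∀ a b c e → a * b * (c * e) ≡ a * (c * (b * e))
  lemma = solve-∀

-- The recurrence of the Leibniz harmonic triangle. Over the common denominator Z the two terms on
-- the right have numerators d+1 and m+1, whose sum is N.
recip-denom : ∀ d m → recip (denom d m) ≡ recip (denom (suc d) m) ℚ.+ recip (denom d (suc m))
recip-denom d m = begin
  recip (denom d m) ≡⟨ recip-scale {denom d m} {N} (ℕ.*-comm (denom d m) N) Z≢0 ⟩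
  recip Z ℚ.* ι N ≡⟨ cong (λ n → recip Z ℚ.* ι n) (sym (cong suc (ℕ.+-suc d m))) ⟩
  recip Z ℚ.* ι (suc d + suc m) ≡⟨ cong (recip Z ℚ.*_) (ι-+ (suc d) (suc m)) ⟩
  recip Z ℚ.* (ι (suc d) ℚ.+ ι (suc m)) ≡⟨ ℚ.*-distribˡ-+ (recip Z) (ι (suc d)) (ι (suc m)) ⟩
  recip Z ℚ.* ι (suc d) ℚ.+ recip Z ℚ.* ι (suc m)
    ≡⟨ cong₂ ℚ._+_ (recip-scale {denom (suc d) m} {suc d} (denom-sucˡ d m) Z≢0) (recip-scale {denom d (suc m)} {suc m} (denom-sucʳ d m) Z≢0) ⟨
  recip (denom (suc d) m) ℚ.+ recip (denom d (suc m)) ∎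
  where
  open ≡-Reasoning
  N Z : ℕ
  N = suc (suc (d + m))
  Z = N * denom d m
  Z≢0 : Z ≢ 0
  Z≢0 = ≢-nonZero⁻¹ Z {{ℕ.m*n≢0 N (denom d m) {{_}} {{≢-nonZero (denom≢0 d m)}}}}

weight : ℕ → ℚ
weight ℓ = negOnePow (ℓ ∸ 1) ℚ.* recip ℓ

-- The functional x^ℓ ↦ (-1)^(ℓ-1)/ℓ on polynomials of degree at most N without constant term.
Φ : ℕ → (ℕ → ℕ) → ℚ
Φ N h = sumℚ N (λ ℓ → weight ℓ ℚ.* ι (h ℓ))

Φ-cong : ∀ N {h h'} → (∀ ℓ → h (suc ℓ) ≡ h' (suc ℓ)) → Φ N h ≡ Φ N h'
Φ-cong zero eq = refl
Φ-cong (suc N) {h} {h'} eq = cong₂ ℚ._+_ (Φ-cong N {h} {h'} eq) (cong (λ x → weight (suc N) ℚ.* ι x) (eq N))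

Φ-+ : ∀ N h h' → Φ N (λ ℓ → h ℓ + h' ℓ) ≡ Φ N h ℚ.+ Φ N h'
Φ-+ zero h h' = refl
Φ-+ (suc N) h h' = trans (cong₂ ℚ._+_ (Φ-+ N h h') (cong (weight (suc N) ℚ.*_) (ι-+ (h (suc N)) (h' (suc N)))))
  (rearrange (Φ N h) (Φ N h') (weight (suc N)) (ι (h (suc N))) (ι (h' (suc N))))
  where
  rearrange : ∀ a b w c d → a ℚ.+ b ℚ.+ w ℚ.* (c ℚ.+ d) ≡ a ℚ.+ w ℚ.* c ℚ.+ (b ℚ.+ w ℚ.* d)
  rearrange = let open +-*-Solver in
    solve 5 (λ a b w c d → a :+ b :+ w :* (c :+ d) := a :+ w :* c :+ (b :+ w :* d)) refl

*ι-zero : ∀ w {x} → x ≡ 0 → w ℚ.* ι x ≡ 0ℚ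
*ι-zero w refl = ℚ.*-zeroʳ w

*ι-one : ∀ w {x} → x ≡ 1 → w ℚ.* ι x ≡ w
*ι-one w refl = ℚ.*-identityʳ w

Φ-0 : ∀ N h → (∀ {ℓ} → ℓ ≤ N → h ℓ ≡ 0) → Φ N h ≡ 0ℚ
Φ-0 zero h eq = refl
Φ-0 (suc N) h eq = trans
  (cong₂ ℚ._+_ (Φ-0 N h (λ ℓ≤N → eq (ℕ.≤-trans ℓ≤N (ℕ.n≤1+n N)))) (*ι-zero (weight (suc N)) (eq ℕ.≤-refl)))
  (ℚ.+-identityʳ 0ℚ)

T-zero-≢ : ∀ d ℓ → suc d ≢ ℓ → T d 0 ℓ ≡ 0
T-zero-≢ d ℓ ≢ with suc d ≟ ℓ
... | yes eq = contradiction eq ≢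
... | no _ = refl

T-zero-≡ : ∀ d → T d 0 (suc d) ≡ 1
T-zero-≡ d with suc d ≟ suc d
... | yes _ = refl
... | no ≢ = contradiction refl ≢

Φ-T-zero : ∀ N d → d < N → Φ N (T d 0) ≡ weight (suc d)
Φ-T-zero (suc N) d d<N = [ earlier , last ]′ (ℕ.m≤n⇒m<n∨m≡n (ℕ.≤-pred d<N))
  where
  earlier : d < N → Φ (suc N) (T d 0) ≡ weight (suc d)
  earlier d<N' = trans
    (cong₂ ℚ._+_ (Φ-T-zero N d d<N')
      (*ι-zero (weight (suc N)) (T-zero-≢ d (suc N) (λ eq → ℕ.<⇒≢ d<N' (ℕ.suc-injective eq)))))
    (ℚ.+-identityʳ (weight (suc d)))

  last : d ≡ N → Φ (suc N) (T d 0) ≡ weight (suc d)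
  last refl = trans
    (cong₂ ℚ._+_ (Φ-0 N (T N 0) (λ {ℓ} ℓ≤N → T-zero-≢ N ℓ (λ { refl → ℕ.1+n≰n ℓ≤N })))
      (*ι-one (weight (suc N)) (T-zero-≡ N)))
    (ℚ.+-identityˡ (weight (suc N)))

-- The bound keeps the degree d+m+1 within the cut-off N. In the induction step the two terms of `T`
-- carry opposite signs, so `recip-denom` leaves just the reciprocal at (d, m+1).
Φ-T : ∀ N d m → d + m < N → Φ N (T d m) ≡ negOnePow d ℚ.* recip (denom d m)
Φ-T N d zero lt = trans (Φ-T-zero N d (subst (_< N) (ℕ.+-identityʳ d) lt))
  (cong (λ x → negOnePow d ℚ.* recip x) (sym (denom-zero d)))
  where
  denom-zero : ∀ d → denom d 0 ≡ suc d
  denom-zero d = trans (cong (λ j → suc j * (j C d)) (ℕ.+-identityʳ d))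
    (trans (cong (suc d *_) (nCn≡1 d)) (ℕ.*-identityʳ (suc d)))
Φ-T N d (suc m) lt = begin
  Φ N (T d (suc m)) ≡⟨ Φ-+ N (T d m) (T (suc d) m) ⟩
  Φ N (T d m) ℚ.+ Φ N (T (suc d) m) ≡⟨ cong₂ ℚ._+_ (Φ-T N d m (ℕ.<-trans (ℕ.n<1+n _) lt')) (Φ-T N (suc d) m lt') ⟩
  negOnePow d ℚ.* recip (denom d m) ℚ.+ ℚ.- negOnePow d ℚ.* recip (denom (suc d) m)
    ≡⟨ cong (λ r → negOnePow d ℚ.* r ℚ.+ ℚ.- negOnePow d ℚ.* recip (denom (suc d) m)) (recip-denom d m) ⟩
  negOnePow d ℚ.* (recip (denom (suc d) m) ℚ.+ recip (denom d (suc m))) ℚ.+ ℚ.- negOnePow d ℚ.* recip (denom (suc d) m)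
    ≡⟨ cancel (negOnePow d) (recip (denom (suc d) m)) (recip (denom d (suc m))) ⟩
  negOnePow d ℚ.* recip (denom d (suc m)) ∎
  where
  open ≡-Reasoning
  lt' : suc (d + m) < N
  lt' = subst (_< N) (ℕ.+-suc d m) lt
  cancel : ∀ s a b → s ℚ.* (a ℚ.+ b) ℚ.+ ℚ.- s ℚ.* a ≡ s ℚ.* b
  cancel = let open +-*-Solver in
    solve 3 (λ s a b → s :* (a :+ b) :+ :- s :* a := s :* b) refl

-- Sums over linear extensions

module _ {k : ℕ} (K : ℕ) where

  countT : List (Vec (Fin k) k) → ℕ → ℕ
  countT [] ℓ = 0
  countT (π ∷ Ls) ℓ = T (des π) (K ∸ des π) ℓ + countT Ls ℓ

  countT≡coeff : ∀ Ls ℓ → countT Ls ℓ ≡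
    coeff (sumP (map (λ π → (xP ^P (1 + des π)) *P (onePlusX ^P (K ∸ des π))) Ls)) ℓ
  countT≡coeff [] ℓ = refl
  countT≡coeff (π ∷ Ls) ℓ = trans (cong₂ _+_ (T≡coeff (des π) (K ∸ des π) ℓ) (countT≡coeff Ls ℓ))
    (sym (coeff-+P ((xP ^P (1 + des π)) *P (onePlusX ^P (K ∸ des π))) _ ℓ))

  countT-0 : ∀ Ls → countT Ls 0 ≡ 0
  countT-0 [] = refl
  countT-0 (π ∷ Ls) = cong₂ _+_ (T-0 (des π) (K ∸ des π)) (countT-0 Ls)

  Φ-countT : ∀ N → K < N → (∀ (π : Vec (Fin k) k) → des π ≤ K) → ∀ Ls → Φ N (countT Ls) ≡
    foldr ℚ._+_ 0ℚ (map (λ π → negOnePow (des π) ℚ.* recip (suc K * (K C des π))) Ls)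
  Φ-countT N K<N des≤ [] = Φ-0 N (countT []) (λ _ → refl)
  Φ-countT N K<N des≤ (π ∷ Ls) = trans (Φ-+ N (T (des π) (K ∸ des π)) (countT Ls))
    (cong₂ ℚ._+_
      (trans (Φ-T N (des π) (K ∸ des π) (subst (_< N) (sym K≡) K<N))
        (cong (λ j → negOnePow (des π) ℚ.* recip (suc j * (j C des π))) K≡))
      (Φ-countT N K<N des≤ Ls))
    where
    K≡ : des π + (K ∸ des π) ≡ K
    K≡ = ℕ.m+[n∸m]≡n (des≤ π)

-- Counting colourings

Unique-concatMap-∷ : ∀ {A : Set} {L} {xs : List A} {ys : List (Vec A L)} → Unique xs → Unique ys →
  Unique (concatMap (λ i → map (i Vec.∷_) ys) xs)
Unique-concatMap-∷ [] uys = []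
Unique-concatMap-∷ {A} {L} {x ∷ xs} {ys} (x∉ ∷ uxs) uys =
  Unique.++⁺ (Unique.map⁺ Vec.∷-injectiveʳ uys) (Unique-concatMap-∷ uxs uys) disjoint
  where
  head∈ : ∀ xs {v : Vec A (suc L)} → v ∈ concatMap (λ i → map (i Vec.∷_) ys) xs → Vec.head v ∈ xs
  head∈ (x ∷ xs) v∈ with ∈-++⁻ (map (x Vec.∷_) ys) v∈
  ... | inj₂ p = there (head∈ xs p)
  ... | inj₁ p with ∈-map⁻ _ p
  ...   | _ , _ , refl = here refl

  disjoint : ∀ {v} → v ∈ map (x Vec.∷_) ys × v ∈ concatMap (λ i → map (i Vec.∷_) ys) xs → ⊥
  disjoint (p , q) with ∈-map⁻ _ p
  ... | _ , _ , refl = All.lookup x∉ (head∈ xs q) refl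

∈-concatMap-∷ : ∀ {A : Set} {L x} {v : Vec A L} {xs ys} → x ∈ xs → v ∈ ys →
  (x ∷ v) ∈ concatMap (λ i → map (i Vec.∷_) ys) xs
∈-concatMap-∷ (here refl) v∈ = ∈-++⁺ˡ (∈-map⁺ _ v∈)
∈-concatMap-∷ {xs = x ∷ xs} {ys} (there x∈) v∈ = ∈-++⁺ʳ (map (x Vec.∷_) ys) (∈-concatMap-∷ x∈ v∈)

allVecs-unique : ∀ ℓ L → Unique (allVecs ℓ L)
allVecs-unique ℓ zero = [] ∷ []
allVecs-unique ℓ (suc L) = Unique-concatMap-∷ (Unique.allFin⁺ ℓ) (allVecs-unique ℓ L)

∈-allVecs : ∀ {ℓ L} (c : Vec (Fin ℓ) L) → c ∈ allVecs ℓ L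
∈-allVecs [] = here refl
∈-allVecs (t ∷ c) = ∈-concatMap-∷ (∈-allFin t) (∈-allVecs c)

pairs : ∀ {k m} → ℕ → List (Vec (Fin k) m) → List (Vec (Fin k) m × Vec ℕ m)
pairs ℓ [] = []
pairs ℓ (π ∷ Ls) = map (π ,_) (words ℓ 0 π) ++ pairs ℓ Ls

∈-pairs⁺ : ∀ {k m} ℓ (Ls : List (Vec (Fin k) m)) {π w} → π ∈ Ls → w ∈ words ℓ 0 π → (π , w) ∈ pairs ℓ Ls
∈-pairs⁺ ℓ (_ ∷ Ls) (here refl) w∈ = ∈-++⁺ˡ (∈-map⁺ _ w∈)
∈-pairs⁺ ℓ (π ∷ Ls) (there π∈) w∈ = ∈-++⁺ʳ (map (π ,_) (words ℓ 0 π)) (∈-pairs⁺ ℓ Ls π∈ w∈)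

∈-pairs⁻ : ∀ {k m} ℓ (Ls : List (Vec (Fin k) m)) {π w} → (π , w) ∈ pairs ℓ Ls → π ∈ Ls × w ∈ words ℓ 0 π
∈-pairs⁻ ℓ (π ∷ Ls) p∈ with ∈-++⁻ (map (π ,_) (words ℓ 0 π)) p∈
... | inj₁ p with ∈-map⁻ _ p
...   | _ , w∈ , refl = here refl , w∈
∈-pairs⁻ ℓ (π ∷ Ls) p∈ | inj₂ p with ∈-pairs⁻ ℓ Ls p
...   | π∈ , w∈ = there π∈ , w∈

pairs-unique : ∀ {k m} ℓ (Ls : List (Vec (Fin k) (suc m))) → Unique Ls → Unique (pairs ℓ Ls)
pairs-unique ℓ [] [] = []
pairs-unique ℓ (π@(a ∷ ρ) ∷ Ls) (π∉ ∷ uniq) =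
  Unique.++⁺ (Unique.map⁺ (cong proj₂) (words-unique ℓ 0 a ρ)) (pairs-unique ℓ Ls uniq) disjoint
  where
  disjoint : ∀ {p} → p ∈ map (π ,_) (words ℓ 0 π) × p ∈ pairs ℓ Ls → ⊥
  disjoint (p , q) with ∈-map⁻ _ p
  ... | _ , _ , refl = All.lookup π∉ (proj₁ (∈-pairs⁻ ℓ Ls q)) refl

length-pairs : ∀ {m} ℓ (Ls : List (Vec (Fin (suc m)) (suc m))) → length (pairs ℓ Ls) ≡ countT m Ls ℓ
length-pairs ℓ [] = refl
length-pairs {m} ℓ (π@(a ∷ ρ) ∷ Ls) = begin
  length (map tag (words ℓ 0 π) ++ pairs ℓ Ls)
    ≡⟨ List.length-++ (map tag (words ℓ 0 π)) {pairs ℓ Ls} ⟩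
  length (map tag (words ℓ 0 π)) + length (pairs ℓ Ls)
    ≡⟨ cong (_+ length (pairs ℓ Ls)) (List.length-map tag (words ℓ 0 π)) ⟩
  length (words ℓ 0 π) + length (pairs ℓ Ls)
    ≡⟨ cong₂ _+_ (length-words ℓ 0 a ρ) (length-pairs ℓ Ls) ⟩
  countT m (π ∷ Ls) ℓ ∎
  where
  open ≡-Reasoning
  tag : Vec ℕ (suc m) → Vec (Fin (suc m)) (suc m) × Vec ℕ (suc m)
  tag w = π , w

-- Order-preserving surjections encoded by a linear extension and a word

LinExt : ∀ {k} → (Fin k → Fin k → Set) → Vec (Fin k) k → Set
LinExt Prec π = (∀ i → i ∈ᵛ π) ×
  (∀ s t → Star Prec (Vec.lookup π s) (Vec.lookup π t) → Vec.lookup π s ≢ Vec.lookup π t → s Fin.< t)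

module OrderPreservingColourings {m L : ℕ} (Prec : Fin (suc m) → Fin (suc m) → Set)
  (Prec⇒< : ∀ {i j} → Prec i j → i Fin.< j)
  (owner : Fin L → Fin (suc m)) (member : ∀ i → ∃[ j ] owner j ≡ i)
  (Ls : List (Vec (Fin (suc m)) (suc m))) (Ls-unique : Unique Ls) (Ls-linExt : ∀ π → (π ∈ Ls) ⇔ LinExt Prec π) where

  private
    k : ℕ
    k = suc m

    Induces : ∀ {ℓ} → Vec (Fin ℓ) L → (Fin k → ℕ) → Set
    Induces = Induced owner

  linExt-injective : ∀ {π} → LinExt Prec π → ∀ {s t} → Vec.lookup π s ≡ Vec.lookup π t → s ≡ t
  linExt-injective {π} (all∈ , _) {s} {t} eq = surjective⇒injective (λ s i → Vec.lookup π s ≡ i)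
    (λ i → ∈ᵛ⇒lookup (all∈ i)) (λ s → Vec.lookup π s , refl) (λ p q → trans (sym p) q) eq refl

  module _ (ℓ : ℕ) where

    -- The edges owned by the s-th entry of π have the s-th letter of w as colour. As a relation, it
    -- can be fed to the pigeonhole lemma in both directions.
    Codes : Vec (Fin ℓ) L → Vec (Fin k) k × Vec ℕ k → Set
    Codes c (π , w) = LinExt Prec π × (∀ j s → owner j ≡ Vec.lookup π s → toℕ (Vec.lookup c j) ≡ Vec.lookup w s)

    codes-word : ∀ {c π w g} → Codes c (π , w) → Induces c g → w ≡ Vec.map g π
    codes-word {c} {π} {w} {g} (_ , codes) induced = lookup-ext λ s →
      let j , owner≡ = member (Vec.lookup π s) in
      trans (sym (codes j s owner≡)) (trans (induced j) (trans (cong g owner≡) (sym (Vec.lookup-map s g π))))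

    induced⇒codes : ∀ {c} → IsSurj c → ∃[ g ] Induces c g × OrderPreserving Prec g → ∃[ p ] p ∈ pairs ℓ Ls × Codes c p
    induced⇒codes {c} surj (g , induced , preserving) =
      (π , Vec.map g π) , ∈-pairs⁺ ℓ Ls (Equivalence.from (Ls-linExt π) linExt) (sorted⇒word g ℓ π sorted g< onto) , linExt , codes
      where
      π : Vec (Fin k) k
      π = sort g id

      all∈ : ∀ i → i ∈ᵛ π
      all∈ = ∈-sort⁺ g id

      sorted : Sorted g π
      sorted = sort-sorted g id id

      star⇒≤ : ∀ {i j} → Star (Prec) i j → g i ≤ g j × i Fin.≤ j
      star⇒≤ ε = ℕ.≤-refl , ℕ.≤-refl
      star⇒≤ (i≺j ◅ rest) with star⇒≤ rest
      ... | g≤ , ≤ = ℕ.≤-trans (preserving i≺j) g≤ , ℕ.≤-trans (ℕ.<⇒≤ (Prec⇒< i≺j)) ≤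

      star⇒Lex : ∀ {i j} → Star (Prec) i j → i ≢ j → Lex g i j
      star⇒Lex star i≢j with star⇒≤ star
      ... | g≤ , ≤ with ℕ.m≤n⇒m<n∨m≡n g≤
      ...   | inj₁ lt = inj₁ lt
      -- For equal values of g the index decides: generating relations lead from smaller to larger
      -- indices.
      ...   | inj₂ eq = inj₂ (eq , ℕ.≤∧≢⇒< ≤ (i≢j ∘ Fin.toℕ-injective))

      linExt : LinExt Prec π
      linExt = all∈ , λ s t star ≢ → ordered s t (star⇒Lex star ≢)
        where
        ordered : ∀ s t → Lex g (Vec.lookup π s) (Vec.lookup π t) → s Fin.< t
        ordered s t lex with Fin.<-cmp s t
        ... | tri< p _ _ = p
        ... | tri≈ _ refl _ = contradiction lex (Lex-irrefl g)
        ... | tri> _ _ p = contradiction (sorted-lookup g π sorted p) (Lex-asym g lex)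

      g< : ∀ i → g i < ℓ
      g< i with member i
      ... | j , refl = subst (_< ℓ) (induced j) (Fin.toℕ<n (Vec.lookup c j))

      onto : ∀ {t} → t < ℓ → ∃[ i ] i ∈ᵛ π × g i ≡ t
      onto t<ℓ with surj (Fin.fromℕ< t<ℓ)
      ... | j , eq = owner j , all∈ (owner j) , trans (sym (induced j)) (trans (cong toℕ eq) (Fin.toℕ-fromℕ< t<ℓ))

      codes : ∀ j s → owner j ≡ Vec.lookup π s → toℕ (Vec.lookup c j) ≡ Vec.lookup (Vec.map g π) s
      codes j s eq = trans (induced j) (trans (cong g eq) (sym (Vec.lookup-map s g π)))

    codes⇒induced : ∀ {p} → p ∈ pairs ℓ Ls →
      ∃[ c ] IsSurj c × (∃[ g ] Induces c g × OrderPreserving Prec g) × Codes c p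
    codes⇒induced {π , w} p∈ = c , surj , (g , induced , preserving) , linExt , codes
      where
      linExt : LinExt Prec π
      linExt = Equivalence.to (Ls-linExt π) (proj₁ (∈-pairs⁻ ℓ Ls p∈))

      place : ∀ i → ∃[ s ] Vec.lookup π s ≡ i
      place i = ∈ᵛ⇒lookup (proj₁ linExt i)

      g : Fin k → ℕ
      g i = Vec.lookup w (proj₁ (place i))

      g-π : ∀ s → g (Vec.lookup π s) ≡ Vec.lookup w s
      g-π s = cong (Vec.lookup w) (linExt-injective {π} linExt (proj₂ (place (Vec.lookup π s))))

      w≡ : w ≡ Vec.map g π
      w≡ = lookup-ext λ s → trans (sym (g-π s)) (sym (Vec.lookup-map s g π))

      sound : Sorted g π × Onto g ℓ 0 π
      sound = word⇒sorted g ℓ π (linExt-injective {π} linExt) (subst (_∈ words ℓ 0 π) w≡ (proj₂ (∈-pairs⁻ ℓ Ls p∈)))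

      sorted : Sorted g π
      sorted = proj₁ sound

      g< : ∀ i → g i < ℓ
      g< i = proj₂ (proj₁ (proj₂ sound) (proj₁ linExt i))

      c : Vec (Fin ℓ) L
      c = Vec.tabulate (λ j → Fin.fromℕ< (g< (owner j)))

      induced : Induces c g
      induced j = trans (cong toℕ (Vec.lookup∘tabulate (λ j → Fin.fromℕ< (g< (owner j))) j)) (Fin.toℕ-fromℕ< (g< (owner j)))

      surj : IsSurj c
      surj t with proj₂ (proj₂ sound) z≤n (Fin.toℕ<n t)
      ... | i , _ , gi≡t with member i
      ...   | j , owner≡ = j , Fin.toℕ-injective (trans (induced j) (trans (cong g owner≡) gi≡t))

      preserving : OrderPreserving Prec g
      preserving {i} {j} i≺j =
        -- A generating relation is a chain of length one between different elements, so π lists i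
        -- before j, and π is sorted by g.
        let s , πs≡i = place i
            t , πt≡j = place j
        in subst₂ (λ i j → g i ≤ g j) πs≡i πt≡j (Lex⇒≤ g (sorted-lookup g π sorted (proj₂ linExt s t
             (subst₂ (Star Prec) (sym πs≡i) (sym πt≡j) (i≺j ◅ ε))
             (λ eq → ℕ.<-irrefl (cong toℕ (trans (sym πs≡i) (trans eq πt≡j))) (Prec⇒< i≺j)))))

      codes : ∀ j s → owner j ≡ Vec.lookup π s → toℕ (Vec.lookup c j) ≡ Vec.lookup w s
      codes j s eq = trans (induced j) (trans (cong g eq) (g-π s))

    codes-injective : ∀ {c c' p} → Codes c p → Codes c' p → c ≡ c'
    codes-injective {p = π , w} ((all∈ , _) , codes) (_ , codes') = lookup-ext λ j →
      let s , eq = ∈ᵛ⇒lookup (all∈ (owner j))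
      in Fin.toℕ-injective (trans (codes j s (sym eq)) (sym (codes' j s (sym eq))))

    -- Each summand owns an edge, so c determines g. Then π is determined as the list of all
    -- summands sorted by `Lex g`, and w as the word of g along π.
    codes-functional : ∀ {c p p'} → p ∈ pairs ℓ Ls → p' ∈ pairs ℓ Ls → Codes c p → Codes c p' → p ≡ p'
    codes-functional {c} {π , w} {π' , w'} p∈ p'∈ codes codes' = cong₂ _,_ π≡π'
      (trans (codes-word {c} {π} {w} {g} codes induced) (trans (cong (Vec.map g) π≡π') (sym (codes-word {c} {π'} {w'} {g} codes' induced))))
      where
      g : Fin k → ℕ
      g i = toℕ (Vec.lookup c (proj₁ (member i)))

      induced : Induces c g
      induced j = let s , eq = ∈ᵛ⇒lookup (proj₁ (proj₁ codes) (owner j)) in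
        trans (proj₂ codes j s (sym eq))
          (sym (proj₂ codes (proj₁ (member (owner j))) s (trans (proj₂ (member (owner j))) (sym eq))))

      sorted : ∀ {π w} → (π , w) ∈ pairs ℓ Ls → Codes c (π , w) → Sorted g π
      sorted {π} {w} p∈ codes = proj₁ (word⇒sorted g ℓ π (linExt-injective {π} (proj₁ codes))
        (subst (_∈ words ℓ 0 π) (codes-word {c} {π} {w} {g} codes induced) (proj₂ (∈-pairs⁻ ℓ Ls p∈))))

      π≡π' : π ≡ π'
      π≡π' = sorted-unique g π π' (sorted p∈ codes) (sorted p'∈ codes')
        (λ {x} _ → proj₁ (proj₁ codes') x) (λ {x} _ → proj₁ (proj₁ codes) x)

    -- `Codes` is injective from colourings to pairs and from pairs to colourings, which gives the
    -- two inequalities between the lengths.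
    length≡countT : ∀ {cs : List (Vec (Fin ℓ) L)} → Unique cs →
      (∀ {c} → c ∈ cs → IsSurj c × ∃[ g ] Induces c g × OrderPreserving Prec g) →
      (∀ {c} → IsSurj c → ∃[ g ] Induces c g × OrderPreserving Prec g → c ∈ cs) →
      length cs ≡ countT m Ls ℓ
    length≡countT cs-unique sound complete = trans (ℕ.≤-antisym
      (injection⇒length-≤ Codes cs-unique
        (λ {c} c∈ → induced⇒codes {c} (proj₁ (sound {c} c∈)) (proj₂ (sound {c} c∈)))
        (λ {c} {c'} {p} _ _ q q' → codes-injective {c} {c'} {p} q q'))
      (injection⇒length-≤ (λ p c → Codes c p) (pairs-unique ℓ Ls Ls-unique)
        (λ p∈ → let c , surj , ind , codes = codes⇒induced p∈ in c , complete {c} surj ind , codes)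
        (λ {p} {p'} {c} p∈ p'∈ q q' → codes-functional {c} {p} {p'} p∈ p'∈ q q')))
      (length-pairs ℓ Ls)

-- The number of good colourings of D

module Counting {n : ℕ} {D : Diagram} (web : IsWeb n D) (E₀ : Diagram) (Es₀ : List Diagram)
  (Es-ok : All (λ E → IsWeb n E × Indecomposable n E) (E₀ ∷ Es₀)) (D≈ : D ≈D ⨁ (E₀ ∷ Es₀))
  (distinct : ∀ i j → i ≢ j → ¬ (lookup (E₀ ∷ Es₀) i ≈D lookup (E₀ ∷ Es₀) j))
  (Ls : List (Vec (Fin (suc (length Es₀))) (suc (length Es₀)))) (Ls-unique : Unique Ls)
  (Ls-linExt : ∀ π → (π ∈ Ls) ⇔ IsLinExt (E₀ ∷ Es₀) π) where

  private
    Es : List Diagram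
    Es = E₀ ∷ Es₀

    k : ℕ
    k = length Es

    copy : Fin k → Diagram
    copy = copyOf Es

    copy-⊆ : ∀ i → copy i ⊆D D
    copy-⊆ i e∈ = proj₂ D≈ (∈-⨁⁺ Es i e∈)

    D⇒copy : ∀ {e} → e ∈ D → ∃[ i ] e ∈ copy i
    D⇒copy e∈ = ∈-⨁⁻ Es (proj₁ D≈ e∈)

    Es-web : ∀ i → IsWeb n (lookup Es i)
    Es-web i = proj₁ (All.lookup Es-ok (∈-lookup i))

    Es-indecomposable : ∀ i → Indecomposable n (lookup Es i)
    Es-indecomposable i = proj₂ (All.lookup Es-ok (∈-lookup i))

    ∈-copy⁺ : ∀ i {e} → e ∈ lookup Es i → addHeights (prefixCount Es i) e ∈ copy i
    ∈-copy⁺ i = ∈-map⁺ (addHeights (prefixCount Es i))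

    ∈-copy⁻ : ∀ i {e} → e ∈ copy i → ∃[ e₀ ] e₀ ∈ lookup Es i × e ≡ addHeights (prefixCount Es i) e₀
    ∈-copy⁻ i = ∈-map⁻ (addHeights (prefixCount Es i))

  open Summands {n} {k} {D} web (lookup Es) (prefixCount Es) Es-web Es-indecomposable (prefixCount-mono Es)
    copy ∈-copy⁺ ∈-copy⁻ copy-⊆ D⇒copy public

  open OrderPreservingColourings (Gen Es) proj₁ owner member Ls Ls-unique Ls-linExt

  f≡countT : ∀ ℓ → f D D ℓ ≡ countT (length Es₀) Ls ℓ
  f≡countT ℓ = length≡countT ℓ (Unique.filter⁺ (good? D D) (allVecs-unique ℓ (length D)))
    (λ {c} c∈ → let surj , 𝓡≈ = proj₂ (∈-filter⁻ (good? D D) {xs = allVecs ℓ (length D)} c∈)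
                in surj , good⇒induced distinct c 𝓡≈)
    (λ {c} surj (g , induced , preserving) →
      ∈-filter⁺ (good? D D) (∈-allVecs c) (surj , induced⇒good c g induced preserving))

⊆[]⇒≡[] : ∀ {D} → D ⊆D [] → D ≡ []
⊆[]⇒≡[] {[]} D⊆ = refl
⊆[]⇒≡[] {e ∷ D} D⊆ = contradiction (D⊆ (here refl)) (λ ())

theorem3p4 : (n : ℕ) (D : Diagram) → IsWeb n D → D ≢ [] →
    (Es : List Diagram) →
    All (λ E → IsWeb n E × Indecomposable n E) Es →
    D ≈D ⨁ Es →
    (∀ i j → i ≢ j → ¬ (lookup Es i ≈D lookup Es j)) →
    (Ls : List (Vec (Fin (length Es)) (length Es))) →
    Unique Ls →
    (∀ π → (π ∈ Ls) ⇔ IsLinExt Es π) →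
    (∀ ℓ → Mcoeff D D ℓ
    ≡ coeff (sumP (map (λ π → (xP ^P (1 + des π))
    *P (onePlusX ^P (length Es ∸ 1 ∸ des π))) Ls)) ℓ)
    × (Rval D D
    ≡ foldr ℚ._+_ 0ℚ
    (map (λ π → negOnePow (des π)
    ℚ.* recip (length Es * ((length Es ∸ 1) C des π))) Ls))
-- No summands would mean an empty D. In the other case k is a successor, so that p - 1 is an honest
-- difference.
theorem3p4 n D web D≢[] [] Es-ok D≈ distinct Ls Ls-unique Ls-linExt =
  contradiction (⊆[]⇒≡[] (proj₁ D≈)) D≢[]
theorem3p4 n D web D≢[] (E₀ ∷ Es₀) Es-ok D≈ distinct Ls Ls-unique Ls-linExt = M , R
  where
  open Counting web E₀ Es₀ Es-ok D≈ distinct Ls Ls-unique Ls-linExt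

  K : ℕ
  K = length Es₀

  M : ∀ ℓ → Mcoeff D D ℓ ≡ coeff (sumP (map (λ π → (xP ^P (1 + des π)) *P (onePlusX ^P (K ∸ des π))) Ls)) ℓ
  -- The left side is 0 by definition, the right side because every term has a factor x.
  M zero = trans (sym (countT-0 K Ls)) (countT≡coeff K Ls 0)
  M (suc ℓ) = trans (f≡countT (suc ℓ)) (countT≡coeff K Ls (suc ℓ))

  R : Rval D D ≡ foldr ℚ._+_ 0ℚ (map (λ π → negOnePow (des π) ℚ.* recip (suc K * (K C des π))) Ls)
  -- `Rval D D` unfolds to `Φ (length D)` of `f D D`, and only the coefficients with ℓ ≥ 1 are
  -- compared.
  R = trans (Φ-cong (length D) {f D D} {countT K Ls} (λ ℓ → f≡countT (suc ℓ)))
    (Φ-countT K (length D) k≤length (λ { (a ∷ π) → des-≤ a π }) Ls)
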